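{- Let $r\in\mathbb{N}$ and $m_1,\ldots,m_r\in\mathbb{N}$. The number of cyclic subgroups of the group $C_{m_1}\times\cdots\times C_{m_r}$ is \[ c(C_{m_1}\times\cdots\times C_{m_r})=\sum_{d_1\mid m_1,\ldots,d_r\mid m_r}\frac{\phi(d_1)\cdots\phi(d_r)}{\phi(\operatorname{lcm}[d_1,\ldots,d_r])}, \] and $(m_1,\ldots,m_r)\mapsto c(C_{m_1}\times\cdots\times C_{m_r})$ is a multiplicative function of $r$ variables. In particular, \[ c(C_{m_1}\times C_{m_2})=\sum_{d_1\mid m_1,\,d_2\mid m_2}\phi(\gcd(d_1,d_2)), \] and for every prime $p$ and all $u,v\in\mathbb{N}$ with $u\ge v$, \[ c(C_{p^u}\times C_{p^v})=2\left(1+p+p^2+\cdots+p^{v-1}\right)+(u-v+1)p^v . \]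
   Context: $\mathbb{N}=\{1,2,\ldots\}$. $C_n$ denotes the cyclic group of order $n$, and $c(G)$ denotes the number of cyclic subgroups of a finite group $G$. $\phi$ is Euler's totient function. A function $f:\mathbb{N}^r\to\mathbb{C}$ is called multiplicative if it is not identically zero and $f(m_1n_1,\ldots,m_rn_r)=f(m_1,\ldots,m_r)f(n_1,\ldots,n_r)$ for all $m_1,\ldots,m_r,n_1,\ldots,n_r\in\mathbb{N}$ with $\gcd(m_1\cdots m_r,n_1\cdots n_r)=1$. -}

module Defs where

open import Data.Bool using (Bool; true; false)
import Data.Bool as Bool
open import Data.Nat using (ℕ; zero; suc; _+_; _*_; _%_)
open import Data.Nat.Divisibility using (_∣?_)
open import Data.Nat.GCD using (gcd)
open import Data.Nat.LCM using (lcm)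
open import Data.List using (List; []; _∷_; [_]; map; concatMap; filter; length; upTo; deduplicate; foldr)
import Data.List.Properties as ListP
open import Data.Vec using (Vec; []; _∷_; zipWith; toList)
import Data.Vec.Properties as VecP
open import Data.Integer using (+_)
open import Data.Rational using (ℚ; _/_; 0ℚ)
open import Relation.Nullary.Decidable using (⌊_⌋)
open import Data.Vec.Relation.Unary.All using (All)
open import Data.Bool.ListAction using (any)

φ : ℕ → ℕ
φ n = length (filter (λ k → gcd k n Data.Nat.≟ 1) (map suc (upTo n)))

divisors : ℕ → List ℕ
divisors n = filter (_∣? n) (map suc (upTo n))

lcmVec : ∀ {r} → Vec ℕ r → ℕ
lcmVec ds = foldr lcm 1 (toList ds)

prodVec : ∀ {r} → Vec ℕ r → ℕ
prodVec ds = foldr _*_ 1 (toList ds)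

tuples : ∀ {r} → Vec (List ℕ) r → List (Vec ℕ r)
tuples [] = [ [] ]
tuples (L ∷ Ls) = concatMap (λ d → map (d ∷_) (tuples Ls)) L

divisorTuples : ∀ {r} → Vec ℕ r → List (Vec ℕ r)
divisorTuples ms = tuples (Data.Vec.map divisors ms)

sumℕ : List ℕ → ℕ
sumℕ = foldr _+_ 0

sumℚ : List ℚ → ℚ
sumℚ = foldr Data.Rational._+_ 0ℚ

-- a / b as a rational number (b = 0 never occurs in our use, since φ(n) ≥ 1 for n ≥ 1)
_//_ : ℕ → ℕ → ℚ
a // zero = 0ℚ
a // suc b = (+ a) / suc b

-- The group C_{m₁} × ⋯ × C_{m_r}, modelled as ℤ/m₁ × ⋯ × ℤ/m_r:
-- elements are vectors (x₁,…,x_r) with 0 ≤ xᵢ < mᵢ, componentwise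
-- addition modulo mᵢ.

modN : ℕ → ℕ → ℕ
modN a zero = a
modN a (suc n) = a % suc n

elems : ∀ {r} → Vec ℕ r → List (Vec ℕ r)
elems ms = tuples (Data.Vec.map upTo ms)

e : ∀ {r} → Vec ℕ r → Vec ℕ r
e [] = []
e (_ ∷ ms) = 0 ∷ e ms

op : ∀ {r} → Vec ℕ r → Vec ℕ r → Vec ℕ r → Vec ℕ r
op ms x y = zipWith modN (zipWith _+_ x y) ms

pow : ∀ {r} → Vec ℕ r → ℕ → Vec ℕ r → Vec ℕ r
pow ms zero x = e ms
pow ms (suc k) x = op ms x (pow ms k x)

-- the cyclic subgroup ⟨x⟩ = { x^k : 0 ≤ k < |G| }, represented as its
-- characteristic vector over the enumeration `elems ms` of the group
cyclicSubgroup : ∀ {r} → Vec ℕ r → Vec ℕ r → List Bool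
cyclicSubgroup ms x =
  map (λ y → any (λ k → ⌊ VecP.≡-dec Data.Nat._≟_ (pow ms k x) y ⌋) (upTo (length (elems ms))))
      (elems ms)

c : ∀ {r} → Vec ℕ r → ℕ
c ms = length (deduplicate (ListP.≡-dec Bool._≟_) (map (cyclicSubgroup ms) (elems ms)))

Positive : ∀ {r} → Vec ℕ r → Set
Positive ms = All (λ m → 1 Data.Nat.≤ m) ms

{-# OPTIONS --safe #-}

-- Call (ord x₁, …, ord x_r) the order vector of x = (x₁, …, x_r).  For dᵢ ∣ mᵢ there are φ(dᵢ)
-- elements of order dᵢ in ℤ/mᵢ, so φ(d₁)⋯φ(d_r) elements have order vector (d₁, …, d_r).  Such an
-- element has order lcm[d₁, …, d_r], all generators of ⟨x⟩ have the same order vector, and ⟨x⟩ has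
-- φ(lcm[d₁, …, d_r]) of them; hence the summand is the number of cyclic subgroups with that order
-- vector, in particular a natural number.  The other claims follow from
-- φ(ga)φ(gb) = φ(g)φ(gab) for coprime a and b, which holds because φ(pn)/φ(n) depends only on
-- whether the prime p divides n.

module Submission where

open import Defs
open import Data.Nat hiding (_/_)
import Data.Nat as ℕ
open import Data.Nat.Coprimality as Coprimality using (Coprime; coprime-+; coprime-divisor; coprime⇒gcd≡1; gcd≡1⇒coprime; coprime-Bézout)
open import Data.Nat.DivMod using (m≡m%n+[m/n]*n; m%n%n≡m%n; m%n<n; m<n⇒m%n≡m; %-remove-+ʳ)
open import Data.Nat.Divisibility
open import Data.Nat.GCD
open import Data.Nat.LCM
open import Data.Nat.ListAction using (product)
open import Data.Nat.ListAction.Properties using (sum-↭)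
open import Data.Nat.Primality using (Prime; prime⇒nonZero; prime⇒nonTrivial; prime⇒irreducible; euclidsLemma)
open import Data.Nat.Primality.Factorisation using (factorise; PrimeFactorisation)
open import Data.Nat.Properties
open import Data.Nat.Tactic.RingSolver using (solve-∀)
open import Data.Bool using (Bool; true; false; T; if_then_else_)
import Data.Bool as Bool
open import Data.Bool.ListAction using (any)
open import Data.Empty using (⊥-elim)
open import Data.List using (List; []; _∷_; _++_; map; length; upTo; filter; concatMap; deduplicate; cartesianProduct; cartesianProductWith)
import Data.List.Properties as ListP
open import Data.List.Membership.Propositional using (_∈_; lose)
open import Data.List.Membership.Propositional.Properties
open import Data.List.Membership.Propositional.Properties.WithK using (unique∧set⇒bag)
open import Data.List.Relation.Binary.BagAndSetEquality using (∼bag⇒↭)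
open import Data.List.Relation.Binary.Permutation.Propositional using (_↭_)
open import Data.List.Relation.Binary.Permutation.Propositional.Properties using (map⁺; ↭-length)
open import Data.List.Relation.Unary.All as All using (All; []; _∷_)
import Data.List.Relation.Unary.All.Properties as AllP
open import Data.List.Relation.Unary.AllPairs using ([]; _∷_)
open import Data.List.Relation.Unary.Any using (here; there; satisfied)
open import Data.List.Relation.Unary.Any.Properties using (any⁺; any⁻)
import Data.List.Relation.Unary.Unique.DecPropositional.Properties as DecUnique
open import Data.List.Relation.Unary.Unique.Propositional using (Unique)
import Data.List.Relation.Unary.Unique.Propositional.Properties as Unique
open import Data.Product using (_×_; _,_; proj₁; proj₂; ∃; uncurry)
open import Data.Sum using (inj₁; inj₂; [_,_]′)
open import Data.Vec using (Vec; []; _∷_; zipWith)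
import Data.Vec as Vec
import Data.Vec.Properties as VecP
import Data.Vec.Relation.Unary.All as VAll
open VAll using ([]; _∷_)
open import Function using (_∘_; id; mk⇔)
open import Relation.Binary.Definitions using (DecidableEquality; tri<; tri≈; tri>)
open import Relation.Binary.PropositionalEquality
open import Relation.Nullary using (Dec; yes; no; does; ¬_)
open import Relation.Nullary.Decidable using (⌊_⌋; toWitness; fromWitness; _×-dec_)
open import Relation.Unary using (Decidable)
open ≡-Reasoning

-- Division is postponed to the very end. The number `N ds` of cyclic subgroups with order vector
-- `ds` is known only through `N ds * φ (lcmVec ds) ≡ prodVec (Vec.map φ ds)`; the totient factor is
-- nonzero, so any number satisfying the same equation equals `N ds`. Multiplicativity and the
-- formula for two factors both amount to exhibiting such a number. No closed formula for `φ` is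
-- used either: the ratio φ(pn)/φ(n), which is p or p - 1, comes from counting residues over p
-- periods of length n. The common-factor identity is applied twice: g = 1 gives φ(ab) = φ(a)φ(b)
-- for coprime a and b, and g = gcd gives φ(a)φ(b) = φ(gcd)φ(lcm), which turns the summand for r = 2
-- into φ(gcd(d₁,d₂)). The main obstacle is that `c` counts distinct Boolean lists, which carry no
-- generator; one generator per subgroup is therefore chosen first, and pairs of a chosen generator
-- and an arbitrary generator of the same subgroup are counted in two ways.

private variable
  A B C P Q : Set
  r : ℕ

-- Finite sums over lists

∑ : List A → (A → ℕ) → ℕ
∑ xs f = sumℕ (map f xs)

∑< : ℕ → (ℕ → ℕ) → ℕ
∑< n f = ∑ (upTo n) f

∑-cong : ∀ {f g : A → ℕ} xs → (∀ x → x ∈ xs → f x ≡ g x) → ∑ xs f ≡ ∑ xs g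
∑-cong []       h = refl
∑-cong (x ∷ xs) h = cong₂ _+_ (h x (here refl)) (∑-cong xs (λ y y∈ → h y (there y∈)))

∑-++ : ∀ (f : A → ℕ) xs ys → ∑ (xs ++ ys) f ≡ ∑ xs f + ∑ ys f
∑-++ f []       ys = refl
∑-++ f (x ∷ xs) ys = trans (cong (f x +_) (∑-++ f xs ys)) (sym (+-assoc (f x) _ _))

∑-map : ∀ (f : B → ℕ) (g : A → B) xs → ∑ (map g xs) f ≡ ∑ xs (f ∘ g)
∑-map f g xs = cong sumℕ (sym (ListP.map-∘ xs))

∑-concatMap : ∀ (f : B → ℕ) (g : A → List B) xs → ∑ (concatMap g xs) f ≡ ∑ xs (λ x → ∑ (g x) f)
∑-concatMap f g []       = refl
∑-concatMap f g (x ∷ xs) = trans (∑-++ f (g x) (concatMap g xs)) (cong (∑ (g x) f +_) (∑-concatMap f g xs))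

∑-zero : ∀ (xs : List A) → ∑ xs (λ _ → 0) ≡ 0
∑-zero []       = refl
∑-zero (x ∷ xs) = ∑-zero xs

∑-one : ∀ (xs : List A) → ∑ xs (λ _ → 1) ≡ length xs
∑-one []       = refl
∑-one (x ∷ xs) = cong suc (∑-one xs)

∑-+ : ∀ (f g : A → ℕ) xs → ∑ xs (λ x → f x + g x) ≡ ∑ xs f + ∑ xs g
∑-+ f g []       = refl
∑-+ f g (x ∷ xs) = trans (cong (f x + g x +_) (∑-+ f g xs)) (interchange (f x) (g x) _ _)
  where
  interchange : ∀ a b c d → a + b + (c + d) ≡ a + c + (b + d)
  interchange = solve-∀

∑-*ˡ : ∀ k (f : A → ℕ) xs → ∑ xs (λ x → k * f x) ≡ k * ∑ xs f
∑-*ˡ k f []       = sym (*-zeroʳ k)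
∑-*ˡ k f (x ∷ xs) = trans (cong (k * f x +_) (∑-*ˡ k f xs)) (sym (*-distribˡ-+ k (f x) _))

∑-*ʳ : ∀ k (f : A → ℕ) xs → ∑ xs (λ x → f x * k) ≡ ∑ xs f * k
∑-*ʳ k f xs = begin
  ∑ xs (λ x → f x * k) ≡⟨ ∑-cong xs (λ x _ → *-comm (f x) k) ⟩
  ∑ xs (λ x → k * f x) ≡⟨ ∑-*ˡ k f xs ⟩
  k * ∑ xs f           ≡⟨ *-comm k _ ⟩
  ∑ xs f * k           ∎

∑-swap : ∀ (f : A → B → ℕ) xs ys → ∑ xs (λ x → ∑ ys (f x)) ≡ ∑ ys (λ y → ∑ xs (λ x → f x y))
∑-swap f []       ys = sym (∑-zero ys)
∑-swap f (x ∷ xs) ys = trans (cong (∑ ys (f x) +_) (∑-swap f xs ys)) (sym (∑-+ (f x) _ ys))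

∑-×  : ∀ (f : A → ℕ) (g : B → ℕ) xs ys → ∑ xs (λ x → ∑ ys (λ y → f x * g y)) ≡ ∑ xs f * ∑ ys g
∑-× f g xs ys = trans (∑-cong xs (λ x _ → ∑-*ˡ (f x) g ys)) (∑-*ʳ (∑ ys g) f xs)

∑-cartesianProductWith : ∀ (f : C → ℕ) (_∙_ : A → B → C) xs ys →
  ∑ (cartesianProductWith _∙_ xs ys) f ≡ ∑ xs (λ x → ∑ ys (λ y → f (x ∙ y)))
∑-cartesianProductWith f _∙_ []       ys = refl
∑-cartesianProductWith f _∙_ (x ∷ xs) ys =
  trans (∑-++ f (map (x ∙_) ys) (cartesianProductWith _∙_ xs ys))
        (cong₂ _+_ (∑-map f (x ∙_) ys) (∑-cartesianProductWith f _∙_ xs ys))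

∑-↭ : ∀ (f : A → ℕ) {xs ys} → xs ↭ ys → ∑ xs f ≡ ∑ ys f
∑-↭ f p = sum-↭ (map⁺ f p)

-- Duplicate-free lists and reindexing

unique∧sameMembers⇒↭ : ∀ {xs ys : List A} → Unique xs → Unique ys →
  (∀ {z} → z ∈ xs → z ∈ ys) → (∀ {z} → z ∈ ys → z ∈ xs) → xs ↭ ys
unique∧sameMembers⇒↭ uxs uys to from = ∼bag⇒↭ (unique∧set⇒bag uxs uys (mk⇔ to from))

-- Injectivity is asked on the list alone: multiplication of pairs is injective on divisors of two
-- coprime numbers, but not on all pairs.
map-unique : ∀ (f : A → B) {xs} → (∀ {x y} → x ∈ xs → y ∈ xs → f x ≡ f y → x ≡ y) →
  Unique xs → Unique (map f xs)
map-unique f inj []        = []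
map-unique f inj (x∉ ∷ uxs) =
  AllP.map⁺ (All.tabulate (λ y∈ fx≡fy → All.lookup x∉ y∈ (inj (here refl) (there y∈) fx≡fy)))
  ∷ map-unique f (λ x∈ y∈ → inj (there x∈) (there y∈)) uxs

bijection⇒length≡ : ∀ (f : A → B) {xs ys} → Unique xs → Unique ys →
  (∀ {x y} → x ∈ xs → y ∈ xs → f x ≡ f y → x ≡ y) →
  (∀ {x} → x ∈ xs → f x ∈ ys) → (∀ {y} → y ∈ ys → ∃ λ x → x ∈ xs × y ≡ f x) →
  length xs ≡ length ys
bijection⇒length≡ f {xs} {ys} uxs uys inj into onto = begin
  length xs         ≡⟨ ListP.length-map f xs ⟨
  length (map f xs) ≡⟨ ↭-length (unique∧sameMembers⇒↭ (map-unique f inj uxs) uys to from) ⟩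
  length ys         ∎
  where
  to : ∀ {z} → z ∈ map f xs → z ∈ ys
  to z∈ with _ , x∈ , refl ← ∈-map⁻ f z∈ = into x∈
  from : ∀ {z} → z ∈ ys → z ∈ map f xs
  from z∈ with _ , x∈ , refl ← onto z∈ = ∈-map⁺ f x∈

-- Indicator functions

⟦_⟧ : Dec P → ℕ
⟦ p? ⟧ = if does p? then 1 else 0

⟦⟧-true : (p? : Dec P) → P → ⟦ p? ⟧ ≡ 1
⟦⟧-true (yes _) _ = refl
⟦⟧-true (no ¬p) p = ⊥-elim (¬p p)

⟦⟧-false : (p? : Dec P) → ¬ P → ⟦ p? ⟧ ≡ 0
⟦⟧-false (yes p) ¬p = ⊥-elim (¬p p)
⟦⟧-false (no _)  _  = refl

⟦⟧-cong : (p? : Dec P) (q? : Dec Q) → (P → Q) → (Q → P) → ⟦ p? ⟧ ≡ ⟦ q? ⟧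
⟦⟧-cong (yes p) q? to from = sym (⟦⟧-true q? (to p))
⟦⟧-cong (no ¬p) q? to from = sym (⟦⟧-false q? (¬p ∘ from))

⟦⟧-× : (p? : Dec P) (q? : Dec Q) → ⟦ p? ×-dec q? ⟧ ≡ ⟦ p? ⟧ * ⟦ q? ⟧
⟦⟧-× (yes _) (yes _) = refl
⟦⟧-× (yes _) (no _)  = refl
⟦⟧-× (no _)  _       = refl

length-filter≡∑ : ∀ {P : A → Set} (P? : Decidable P) xs → length (filter P? xs) ≡ ∑ xs (λ x → ⟦ P? x ⟧)
length-filter≡∑ P? []       = refl
length-filter≡∑ P? (x ∷ xs) with P? x
... | yes _ = cong suc (length-filter≡∑ P? xs)
... | no  _ = length-filter≡∑ P? xs

module _ (_≟ᴬ_ : DecidableEquality A) where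

  private
    absent : ∀ {x : A} xs → All (x ≢_) xs → ∑ xs (λ y → ⟦ x ≟ᴬ y ⟧) ≡ 0
    absent []       []         = refl
    absent (y ∷ xs) (x≢y ∷ x∉) = cong₂ _+_ (⟦⟧-false (_ ≟ᴬ y) x≢y) (absent xs x∉)

  -- Serves twice in the final count: every element has exactly one order vector, and every cyclic
  -- subgroup occurs exactly once after deduplication.
  ∑-δ : ∀ {x : A} {xs} → Unique xs → x ∈ xs → ∑ xs (λ y → ⟦ x ≟ᴬ y ⟧) ≡ 1
  ∑-δ {x} {_ ∷ xs} (x∉ ∷ _)  (here refl) = cong₂ _+_ (⟦⟧-true (x ≟ᴬ x) refl) (absent xs x∉)
  ∑-δ {x} {y ∷ _}  (y∉ ∷ u) (there x∈)  =
    cong₂ _+_ (⟦⟧-false (x ≟ᴬ y) (λ x≡y → All.lookup y∉ x∈ (sym x≡y))) (∑-δ u x∈)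

-- Sums over initial segments

∑<-suc : ∀ n f → ∑< (suc n) f ≡ f 0 + ∑< n (f ∘ suc)
∑<-suc n f = cong (f 0 +_) (cong sumℕ (trans (ListP.map-applyUpTo suc f n) (sym (ListP.map-upTo (f ∘ suc) n))))

∑<-last : ∀ n f → ∑< (suc n) f ≡ ∑< n f + f n
∑<-last n f = begin
  ∑ (upTo (suc n)) f         ≡⟨ cong (λ xs → ∑ xs f) (ListP.applyUpTo-∷ʳ id n) ⟨
  ∑ (upTo n ++ n ∷ []) f     ≡⟨ ∑-++ f (upTo n) (n ∷ []) ⟩
  ∑< n f + (f n + 0)         ≡⟨ cong (∑< n f +_) (+-identityʳ (f n)) ⟩
  ∑< n f + f n               ∎

∑<-cong : ∀ n {f g} → (∀ i → i < n → f i ≡ g i) → ∑< n f ≡ ∑< n g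
∑<-cong n h = ∑-cong (upTo n) (λ i i∈ → h i (∈-upTo⁻ i∈))

∑<-+ : ∀ m n f → ∑< (m + n) f ≡ ∑< m f + ∑< n (f ∘ (m +_))
∑<-+ zero    n f = refl
∑<-+ (suc m) n f = begin
  ∑< (suc (m + n)) f                            ≡⟨ ∑<-suc (m + n) f ⟩
  f 0 + ∑< (m + n) (f ∘ suc)                    ≡⟨ cong (f 0 +_) (∑<-+ m n (f ∘ suc)) ⟩
  f 0 + (∑< m (f ∘ suc) + ∑< n (f ∘ (suc m +_))) ≡⟨ +-assoc (f 0) _ _ ⟨
  f 0 + ∑< m (f ∘ suc) + ∑< n (f ∘ (suc m +_))   ≡⟨ cong (_+ ∑< n (f ∘ (suc m +_))) (∑<-suc m f) ⟨
  ∑< (suc m) f + ∑< n (f ∘ (suc m +_))           ∎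

∑<-periodic : ∀ k n f → (∀ i → f (n + i) ≡ f i) → ∑< (k * n) f ≡ k * ∑< n f
∑<-periodic zero    n f h = refl
∑<-periodic (suc k) n f h = begin
  ∑< (n + k * n) f                  ≡⟨ ∑<-+ n (k * n) f ⟩
  ∑< n f + ∑< (k * n) (f ∘ (n +_))  ≡⟨ cong (∑< n f +_) (∑<-cong (k * n) (λ i _ → h i)) ⟩
  ∑< n f + ∑< (k * n) f             ≡⟨ cong (∑< n f +_) (∑<-periodic k n f h) ⟩
  ∑< n f + k * ∑< n f               ∎

-- Coprimality and divisibility

coprime-∣ : ∀ {a b a′ b′} → a′ ∣ a → b′ ∣ b → Coprime a b → Coprime a′ b′
coprime-∣ a′∣a b′∣b co (d∣a′ , d∣b′) = co (∣-trans d∣a′ a′∣a , ∣-trans d∣b′ b′∣b)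

coprime-*ʳ : ∀ {k a b} → Coprime k a → Coprime k b → Coprime k (a * b)
coprime-*ʳ ka kb (d∣k , d∣ab) = kb (d∣k , coprime-divisor (coprime-∣ d∣k ∣-refl ka) d∣ab)

coprime-*ˡ : ∀ {k a b} → Coprime a k → Coprime b k → Coprime (a * b) k
coprime-*ˡ ak bk = Coprimality.sym (coprime-*ʳ (Coprimality.sym ak) (Coprimality.sym bk))

coprime-*-∣ : ∀ {a b n} → Coprime a b → a ∣ n → b ∣ n → a * b ∣ n
coprime-*-∣ {a} {b} co (divides q refl) b∣n =
  subst (a * b ∣_) (*-comm a q) (*-monoʳ-∣ a (coprime-divisor (Coprimality.sym co) (subst (b ∣_) (*-comm q a) b∣n)))

prime∤⇒coprime : ∀ {p n} → Prime p → p ∤ n → Coprime p n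
prime∤⇒coprime pp p∤n (d∣p , d∣n) with prime⇒irreducible pp d∣p
... | inj₁ d≡1  = d≡1
... | inj₂ refl = ⊥-elim (p∤n d∣n)

prime-coprime-∤ : ∀ {p a b} → Prime p → Coprime a b → p ∣ a → p ∤ b
prime-coprime-∤ pp co p∣a p∣b = nonTrivial⇒≢1 {{prime⇒nonTrivial pp}} (co (p∣a , p∣b))

∣-nonZero : ∀ {n} {{_ : NonZero n}} {m} → m ∣ n → NonZero m
∣-nonZero {n} {m = zero} 0∣n = ⊥-elim (≢-nonZero⁻¹ n (0∣⇒≡0 0∣n))
∣-nonZero {m = suc _} _ = _

-- The totient function

coprimeTo : ℕ → ℕ → ℕ
coprimeTo n k = ⟦ gcd k n ≟ 1 ⟧

coprimeTo-cong : ∀ n k n′ k′ → (Coprime k n → Coprime k′ n′) → (Coprime k′ n′ → Coprime k n) →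
  coprimeTo n k ≡ coprimeTo n′ k′
coprimeTo-cong n k n′ k′ to from = ⟦⟧-cong (gcd k n ≟ 1) (gcd k′ n′ ≟ 1)
  (coprime⇒gcd≡1 ∘ to ∘ gcd≡1⇒coprime) (coprime⇒gcd≡1 ∘ from ∘ gcd≡1⇒coprime)

coprimeTo-periodic : ∀ n k → coprimeTo n (n + k) ≡ coprimeTo n k
coprimeTo-periodic n k = coprimeTo-cong n (n + k) n k
  (λ co (d∣k , d∣n) → co (∣m∣n⇒∣m+n d∣n d∣k , d∣n)) coprime-+

-- `φ` ranges over 1, ..., n, whereas residues are 0, ..., n - 1. By periodicity the terms at n and
-- at 0 agree; adding that common term to both sides gives the same sum over 0, ..., n.
φ≡∑ : ∀ n → φ n ≡ ∑< n (coprimeTo n)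
φ≡∑ n = begin
  φ n                                  ≡⟨ length-filter≡∑ (λ k → gcd k n ≟ 1) (map suc (upTo n)) ⟩
  ∑ (map suc (upTo n)) (coprimeTo n)   ≡⟨ ∑-map (coprimeTo n) suc (upTo n) ⟩
  ∑< n (coprimeTo n ∘ suc)             ≡⟨ +-cancelˡ-≡ (coprimeTo n 0) _ _ shift ⟩
  ∑< n (coprimeTo n)                   ∎
  where
  shift : coprimeTo n 0 + ∑< n (coprimeTo n ∘ suc) ≡ coprimeTo n 0 + ∑< n (coprimeTo n)
  shift = begin
    coprimeTo n 0 + ∑< n (coprimeTo n ∘ suc)  ≡⟨ ∑<-suc n (coprimeTo n) ⟨
    ∑< (suc n) (coprimeTo n)                  ≡⟨ ∑<-last n (coprimeTo n) ⟩
    ∑< n (coprimeTo n) + coprimeTo n n        ≡⟨ +-comm _ (coprimeTo n n) ⟩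
    coprimeTo n n + ∑< n (coprimeTo n)        ≡⟨ cong (λ k → coprimeTo n k + ∑< n (coprimeTo n)) (+-identityʳ n) ⟨
    coprimeTo n (n + 0) + ∑< n (coprimeTo n)  ≡⟨ cong (_+ ∑< n (coprimeTo n)) (coprimeTo-periodic n 0) ⟩
    coprimeTo n 0 + ∑< n (coprimeTo n)        ∎

-- The witness is 1, since gcd 1 n = 1. This is what later permits cancelling totients.
φ-nonZero : ∀ n → {{NonZero n}} → NonZero (φ n)
φ-nonZero n@(suc n-1) = member⇒nonZero
  (∈-filter⁺ (λ k → gcd k n ≟ 1) (∈-map⁺ suc (∈-upTo⁺ (s≤s (z≤n {n-1})))) (gcd-zeroˡ n))
  where
  member⇒nonZero : ∀ {x : ℕ} {xs} → x ∈ xs → NonZero (length xs)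
  member⇒nonZero {xs = _ ∷ _} _ = _

-- The range splits into n blocks of length g, and only the first entry of each block is a multiple
-- of g. The induction removes one block and shifts `h` by g.
∑-multiples : ∀ n g {{_ : NonZero g}} (h : ℕ → ℕ) → ∑< (n * g) (λ x → ⟦ g ∣? x ⟧ * h x) ≡ ∑< n (λ y → h (y * g))
∑-multiples zero    g h = refl
∑-multiples (suc n) g@(suc g-1) h = begin
  ∑< (g + n * g) F                                            ≡⟨ ∑<-+ g (n * g) F ⟩
  ∑< g F + ∑< (n * g) (F ∘ (g +_))                            ≡⟨ cong₂ _+_ firstBlock laterBlocks ⟩
  h 0 + ∑< n (λ y → h (g + y * g))                            ≡⟨ ∑<-suc n (λ y → h (y * g)) ⟨
  ∑< (suc n) (λ y → h (y * g))                                ∎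
  where
  F : ℕ → ℕ
  F x = ⟦ g ∣? x ⟧ * h x
  firstBlock : ∑< g F ≡ h 0
  firstBlock = begin
    ∑< g F                    ≡⟨ ∑<-suc g-1 F ⟩
    F 0 + ∑< g-1 (F ∘ suc)    ≡⟨ cong₂ _+_ (cong (_* h 0) (⟦⟧-true (g ∣? 0) (g ∣0)))
                                  (∑<-cong g-1 (λ i i<g-1 → cong (_* h (suc i))
                                    (⟦⟧-false (g ∣? suc i) (>⇒∤ (s≤s i<g-1))))) ⟩
    1 * h 0 + ∑< g-1 (λ _ → 0) ≡⟨ cong₂ _+_ (*-identityˡ (h 0)) (∑-zero (upTo g-1)) ⟩
    h 0 + 0                   ≡⟨ +-identityʳ (h 0) ⟩
    h 0                       ∎
  laterBlocks : ∑< (n * g) (F ∘ (g +_)) ≡ ∑< n (λ y → h (g + y * g))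
  laterBlocks = trans
    (∑<-cong (n * g) (λ x _ → cong (_* h (g + x)) (⟦⟧-cong (g ∣? (g + x)) (g ∣? x)
      (λ g∣g+x → ∣m+n∣m⇒∣n g∣g+x ∣-refl) (∣m∣n⇒∣m+n ∣-refl))))
    (∑-multiples n g (h ∘ (g +_)))

φ-*-∣ : ∀ {p n} → p ∣ n → φ (p * n) ≡ p * φ n
φ-*-∣ {p} {n} p∣n = begin
  φ (p * n)                       ≡⟨ φ≡∑ (p * n) ⟩
  ∑< (p * n) (coprimeTo (p * n))  ≡⟨ ∑<-cong (p * n) (λ k _ → coprimeTo-cong (p * n) k n k
                                       (λ co → coprime-∣ ∣-refl (n∣m*n p) co)
                                       (λ co → coprime-*ʳ (coprime-∣ ∣-refl p∣n co) co)) ⟩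
  ∑< (p * n) (coprimeTo n)        ≡⟨ ∑<-periodic p n (coprimeTo n) (coprimeTo-periodic n) ⟩
  p * ∑< n (coprimeTo n)          ≡⟨ cong (p *_) (φ≡∑ n) ⟨
  p * φ n                         ∎

-- Over p periods, p φ(n) residues are coprime to n. Those divisible by p are the p·y with y < n
-- coprime to n, φ(n) in number; the others are exactly the residues coprime to p·n.
φ-*-∤ : ∀ {p n} → Prime p → p ∤ n → φ (p * n) ≡ (p ∸ 1) * φ n
φ-*-∤ {p} {n} pp p∤n = begin
  φ (p * n)                   ≡⟨ m+n∸n≡m (φ (p * n)) (φ n) ⟨
  φ (p * n) + φ n ∸ φ n       ≡⟨ cong₂ _∸_ complement (sym (*-identityˡ (φ n))) ⟩
  p * φ n ∸ 1 * φ n           ≡⟨ *-distribʳ-∸ (φ n) p 1 ⟨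
  (p ∸ 1) * φ n               ∎
  where
  instance _ = prime⇒nonZero pp
  coprime-pn : Coprime p n
  coprime-pn = prime∤⇒coprime pp p∤n
  multiples : ∑< (p * n) (λ x → ⟦ p ∣? x ⟧ * coprimeTo n x) ≡ φ n
  multiples = begin
    ∑< (p * n) (λ x → ⟦ p ∣? x ⟧ * coprimeTo n x) ≡⟨ cong (λ N → ∑< N (λ x → ⟦ p ∣? x ⟧ * coprimeTo n x)) (*-comm p n) ⟩
    ∑< (n * p) (λ x → ⟦ p ∣? x ⟧ * coprimeTo n x) ≡⟨ ∑-multiples n p (coprimeTo n) ⟩
    ∑< n (λ y → coprimeTo n (y * p))              ≡⟨ ∑<-cong n (λ y _ → coprimeTo-cong n (y * p) n y
                                                      (coprime-∣ (m∣m*n p) ∣-refl)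
                                                      (λ co → coprime-*ˡ co coprime-pn)) ⟩
    ∑< n (coprimeTo n)                            ≡⟨ φ≡∑ n ⟨
    φ n                                           ∎
  split : ∀ x → coprimeTo n x ≡ coprimeTo (p * n) x + ⟦ p ∣? x ⟧ * coprimeTo n x
  split x with p ∣? x
  ... | yes p∣x = sym (cong₂ _+_ (⟦⟧-false (gcd x (p * n) ≟ 1) not-coprime) (*-identityˡ (coprimeTo n x)))
    where
    not-coprime : gcd x (p * n) ≢ 1
    -- The common divisor p would have to be 1, and 1 divides n.
    not-coprime eq = p∤n (subst (_∣ n) (sym (gcd≡1⇒coprime {x} eq (p∣x , m∣m*n n))) (1∣ n))
  ... | no  p∤x = trans (coprimeTo-cong n x (p * n) x
        (λ co → coprime-*ʳ (Coprimality.sym (prime∤⇒coprime pp p∤x)) co)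
        (coprime-∣ ∣-refl (n∣m*n p)))
        (sym (+-identityʳ (coprimeTo (p * n) x)))
  complement : φ (p * n) + φ n ≡ p * φ n
  complement = begin
    φ (p * n) + φ n ≡⟨ cong₂ _+_ (φ≡∑ (p * n)) (sym multiples) ⟩
    ∑< (p * n) (coprimeTo (p * n)) + ∑< (p * n) (λ x → ⟦ p ∣? x ⟧ * coprimeTo n x)
      ≡⟨ ∑-+ (coprimeTo (p * n)) _ (upTo (p * n)) ⟨
    ∑< (p * n) (λ x → coprimeTo (p * n) x + ⟦ p ∣? x ⟧ * coprimeTo n x)
      ≡⟨ ∑<-cong (p * n) (λ x _ → sym (split x)) ⟩
    ∑< (p * n) (coprimeTo n) ≡⟨ ∑<-periodic p n (coprimeTo n) (coprimeTo-periodic n) ⟩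
    p * ∑< n (coprimeTo n)   ≡⟨ cong (p *_) (φ≡∑ n) ⟨
    p * φ n                  ∎

-- Only divisibility of n by p matters, so n and n * b have the same factor when p ∤ b.
φ-*-factor : ∀ {p b} n → Prime p → p ∤ b → ∃ λ k → φ (p * n) ≡ k * φ n × φ (p * (n * b)) ≡ k * φ (n * b)
φ-*-factor {p} {b} n pp p∤b with p ∣? n
... | yes p∣n = p , φ-*-∣ p∣n , φ-*-∣ (∣m⇒∣m*n b p∣n)
... | no  p∤n = p ∸ 1 , φ-*-∤ pp p∤n , φ-*-∤ pp ([ p∤n , p∤b ]′ ∘ euclidsLemma n b pp)

-- Induction over the prime factors of a. A prime p of a does not divide b, so inserting p
-- multiplies φ(gΠ) and φ(gΠb) by the same k, and both sides grow alike.
φ-common-factor : ∀ g {a b} {{_ : NonZero a}} → Coprime a b → φ (g * a) * φ (g * b) ≡ φ g * φ (g * a * b)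
φ-common-factor g {a} {b} co = subst (λ a → φ (g * a) * φ (g * b) ≡ φ g * φ (g * a * b)) (sym isFactorisation)
  (overPrimes factors factorsPrime (subst (λ a → Coprime a b) isFactorisation co))
  where
  open PrimeFactorisation (factorise a)
  overPrimes : ∀ ps → All Prime ps → Coprime (product ps) b →
    φ (g * product ps) * φ (g * b) ≡ φ g * φ (g * product ps * b)
  overPrimes []       []         _  = cong₂ (λ u v → φ u * φ (v * b)) (*-identityʳ g) (sym (*-identityʳ g))
  overPrimes (p ∷ ps) (pp ∷ pps) co
    with k , eq₁ , eq₂ ← φ-*-factor {b = b} (g * product ps) pp (prime-coprime-∤ pp co (m∣m*n (product ps))) = begin
    φ (g * (p * Π)) * φ (g * b)  ≡⟨ cong (λ u → φ u * φ (g * b)) (left-commute g p Π) ⟩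
    φ (p * (g * Π)) * φ (g * b)  ≡⟨ cong (_* φ (g * b)) eq₁ ⟩
    k * φ (g * Π) * φ (g * b)    ≡⟨ *-assoc k _ _ ⟩
    k * (φ (g * Π) * φ (g * b))  ≡⟨ cong (k *_) (overPrimes ps pps (coprime-∣ (n∣m*n p) ∣-refl co)) ⟩
    k * (φ g * φ (g * Π * b))    ≡⟨ left-commute k (φ g) _ ⟩
    φ g * (k * φ (g * Π * b))    ≡⟨ cong (φ g *_) eq₂ ⟨
    φ g * φ (p * (g * Π * b))    ≡⟨ cong (λ u → φ g * φ u) (regroup p g Π b) ⟩
    φ g * φ (g * (p * Π) * b)    ∎
    where
    Π : ℕ
    Π = product ps
    left-commute : ∀ x y z → x * (y * z) ≡ y * (x * z)
    left-commute = solve-∀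
    regroup : ∀ p g Π b → p * (g * Π * b) ≡ g * (p * Π) * b
    regroup = solve-∀

φ-*-coprime : ∀ {a b} {{_ : NonZero a}} → Coprime a b → φ (a * b) ≡ φ a * φ b
φ-*-coprime {a} {b} co = sym (begin
  φ a * φ b               ≡⟨ cong₂ (λ u v → φ u * φ v) (*-identityˡ a) (*-identityˡ b) ⟨
  φ (1 * a) * φ (1 * b)   ≡⟨ φ-common-factor 1 co ⟩
  1 * φ (1 * a * b)       ≡⟨ *-identityˡ _ ⟩
  φ (1 * a * b)           ≡⟨ cong (λ u → φ (u * b)) (*-identityˡ a) ⟩
  φ (a * b)               ∎)

gcd-decomposition : ∀ a b {{_ : NonZero a}} → ∃ λ a′ → ∃ λ b′ →
  a ≡ gcd a b * a′ × b ≡ gcd a b * b′ × Coprime a′ b′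
gcd-decomposition a b = quotient g∣a , quotient g∣b , a≡ , b≡ , gcd≡1⇒coprime coprime
  where
  g∣a : gcd a b ∣ a
  g∣a = gcd[m,n]∣m a b
  g∣b : gcd a b ∣ b
  g∣b = gcd[m,n]∣n a b
  a≡ : a ≡ gcd a b * quotient g∣a
  a≡ = m∣n⇒n≡m*quotient g∣a
  b≡ : b ≡ gcd a b * quotient g∣b
  b≡ = m∣n⇒n≡m*quotient g∣b
  instance
    g≢0 : NonZero (gcd a b)
    g≢0 = ∣-nonZero g∣a
  coprime : gcd (quotient g∣a) (quotient g∣b) ≡ 1
  coprime = *-cancelˡ-≡ _ 1 (gcd a b) (begin
    gcd a b * gcd (quotient g∣a) (quotient g∣b)               ≡⟨ c*gcd[m,n]≡gcd[cm,cn] (gcd a b) _ _ ⟩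
    gcd (gcd a b * quotient g∣a) (gcd a b * quotient g∣b)     ≡⟨ cong₂ gcd a≡ b≡ ⟨
    gcd a b                                                   ≡⟨ *-identityʳ (gcd a b) ⟨
    gcd a b * 1                                               ∎)

φ-gcd-lcm : ∀ a b {{_ : NonZero a}} → φ a * φ b ≡ φ (gcd a b) * φ (lcm a b)
φ-gcd-lcm a b with a′ , b′ , a≡ , b≡ , co ← gcd-decomposition a b = begin
  φ a * φ b                             ≡⟨ cong₂ (λ u v → φ u * φ v) a≡ b≡ ⟩
  φ (gcd a b * a′) * φ (gcd a b * b′)   ≡⟨ φ-common-factor (gcd a b) co ⟩
  φ (gcd a b) * φ (gcd a b * a′ * b′)   ≡⟨ cong (λ u → φ (gcd a b) * φ u) lcm≡ ⟩
  φ (gcd a b) * φ (lcm a b)             ∎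
  where
  instance
    g≢0 : NonZero (gcd a b)
    g≢0 = ∣-nonZero (gcd[m,n]∣m a b)
    a′≢0 : NonZero a′
    a′≢0 = ∣-nonZero (subst (a′ ∣_) (sym a≡) (n∣m*n (gcd a b)))
  lcm≡ : gcd a b * a′ * b′ ≡ lcm a b
  lcm≡ = *-cancelˡ-≡ _ _ (gcd a b) (begin
    gcd a b * (gcd a b * a′ * b′)     ≡⟨ regroup (gcd a b) a′ b′ ⟩
    gcd a b * a′ * (gcd a b * b′)     ≡⟨ cong₂ _*_ a≡ b≡ ⟨
    a * b                             ≡⟨ gcd*lcm a b ⟨
    gcd a b * lcm a b                 ∎)
    where
    regroup : ∀ g x y → g * (g * x * y) ≡ g * x * (g * y)
    regroup = solve-∀

-- Tuples of divisors and of residues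

∑-tuples : ∀ (f : Vec ℕ (suc r) → ℕ) L (Ls : Vec (List ℕ) r) →
  ∑ (tuples (L ∷ Ls)) f ≡ ∑ L (λ d → ∑ (tuples Ls) (λ ds → f (d ∷ ds)))
∑-tuples f L Ls = trans (∑-concatMap f (λ d → map (d ∷_) (tuples Ls)) L)
                        (∑-cong L (λ d _ → ∑-map f (d ∷_) (tuples Ls)))

-- Membership and uniqueness for `tuples` are both obtained from those of `cartesianProductWith`.
tuples-∷ : ∀ L (Ls : Vec (List ℕ) r) → tuples (L ∷ Ls) ≡ cartesianProductWith _∷_ L (tuples Ls)
tuples-∷ []      Ls = refl
tuples-∷ (d ∷ L) Ls = cong (map (d ∷_) (tuples Ls) ++_) (tuples-∷ L Ls)

tuples-unique : ∀ {Ls : Vec (List ℕ) r} → VAll.All Unique Ls → Unique (tuples Ls)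
tuples-unique []                       = [] ∷ []
tuples-unique {Ls = L ∷ Ls} (uL ∷ uLs) = subst Unique (sym (tuples-∷ L Ls))
  (Unique.cartesianProductWith⁺ _∷_ VecP.∷-injective uL (tuples-unique uLs))

∈-tuples⁺ : ∀ {d L ds} {Ls : Vec (List ℕ) r} → d ∈ L → ds ∈ tuples Ls → d ∷ ds ∈ tuples (L ∷ Ls)
∈-tuples⁺ {L = L} {Ls = Ls} d∈ ds∈ =
  subst (_ ∈_) (sym (tuples-∷ L Ls)) (∈-cartesianProductWith⁺ _∷_ d∈ ds∈)

∈-tuples⁻ : ∀ {d ds} L (Ls : Vec (List ℕ) r) → d ∷ ds ∈ tuples (L ∷ Ls) → d ∈ L × ds ∈ tuples Ls
∈-tuples⁻ L Ls d∷ds∈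
  with _ , _ , d∈ , ds∈ , refl ← ∈-cartesianProductWith⁻ _∷_ L (tuples Ls) (subst (_ ∈_) (tuples-∷ L Ls) d∷ds∈)
  = d∈ , ds∈

length-tuples : ∀ (Ls : Vec (List ℕ) r) → length (tuples Ls) ≡ prodVec (Vec.map length Ls)
length-tuples []       = refl
length-tuples (L ∷ Ls) = begin
  length (tuples (L ∷ Ls))                   ≡⟨ ∑-one (tuples (L ∷ Ls)) ⟨
  ∑ (tuples (L ∷ Ls)) (λ _ → 1)              ≡⟨ ∑-tuples (λ _ → 1) L Ls ⟩
  ∑ L (λ _ → ∑ (tuples Ls) (λ _ → 1 * 1))    ≡⟨ ∑-× (λ _ → 1) (λ _ → 1) L (tuples Ls) ⟩
  ∑ L (λ _ → 1) * ∑ (tuples Ls) (λ _ → 1)    ≡⟨ cong₂ _*_ (∑-one L) (trans (∑-one (tuples Ls)) (length-tuples Ls)) ⟩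
  length L * prodVec (Vec.map length Ls)     ∎

∈-divisors⁺ : ∀ {d m} {{_ : NonZero m}} → d ∣ m → d ∈ divisors m
∈-divisors⁺ {zero}  {m} 0∣m = ⊥-elim (≢-nonZero⁻¹ m (0∣⇒≡0 0∣m))
∈-divisors⁺ {suc d} {m} d∣m = ∈-filter⁺ (_∣? m) (∈-map⁺ suc (∈-upTo⁺ (∣⇒≤ d∣m))) d∣m

∈-divisors⁻ : ∀ {d} m → d ∈ divisors m → d ∣ m
∈-divisors⁻ m d∈ = proj₂ (∈-filter⁻ (_∣? m) {xs = map suc (upTo m)} d∈)

divisors-unique : ∀ m → Unique (divisors m)
divisors-unique m = Unique.filter⁺ (_∣? m) (Unique.map⁺ suc-injective (Unique.upTo⁺ m))

divisorTuples-unique : ∀ (ms : Vec ℕ r) → Unique (divisorTuples ms)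
divisorTuples-unique ms = tuples-unique (all ms)
  where
  all : ∀ {r} (ms : Vec ℕ r) → VAll.All Unique (Vec.map divisors ms)
  all []       = []
  all (m ∷ ms) = divisors-unique m ∷ all ms

elems-unique : ∀ (ms : Vec ℕ r) → Unique (elems ms)
elems-unique ms = tuples-unique (all ms)
  where
  all : ∀ {r} (ms : Vec ℕ r) → VAll.All Unique (Vec.map upTo ms)
  all []       = []
  all (m ∷ ms) = Unique.upTo⁺ m ∷ all ms

length-elems : ∀ (ms : Vec ℕ r) → length (elems ms) ≡ prodVec ms
length-elems ms = trans (length-tuples (Vec.map upTo ms)) (lengths ms)
  where
  lengths : ∀ {r} (ms : Vec ℕ r) → prodVec (Vec.map length (Vec.map upTo ms)) ≡ prodVec ms
  lengths []       = refl
  lengths (m ∷ ms) = cong₂ _*_ (ListP.length-upTo m) (lengths ms)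

prodVec-positive : ∀ {ms : Vec ℕ r} → Positive ms → NonZero (prodVec ms)
prodVec-positive []         = _
prodVec-positive {ms = m ∷ ms} (m>0 ∷ ms>0) = m*n≢0 m (prodVec ms) {{>-nonZero m>0}} {{prodVec-positive ms>0}}

∈-divisorTuples⁻ : ∀ {d ds} m (ms : Vec ℕ r) → d ∷ ds ∈ divisorTuples (m ∷ ms) → d ∣ m × ds ∈ divisorTuples ms
∈-divisorTuples⁻ m ms d∷ds∈ with d∈ , ds∈ ← ∈-tuples⁻ (divisors m) (Vec.map divisors ms) d∷ds∈ = ∈-divisors⁻ m d∈ , ds∈

divisorTuples-prodVec-∣ : ∀ {ds : Vec ℕ r} ms → ds ∈ divisorTuples ms → prodVec ds ∣ prodVec ms
divisorTuples-prodVec-∣ {ds = []}    []       _  = ∣-refl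
divisorTuples-prodVec-∣ {ds = _ ∷ _} (m ∷ ms) d∈ with d∣m , ds∈ms ← ∈-divisorTuples⁻ m ms d∈ =
  *-pres-∣ d∣m (divisorTuples-prodVec-∣ ms ds∈ms)

divisorTuples-positive : ∀ {ds ms : Vec ℕ r} → Positive ms → ds ∈ divisorTuples ms → Positive ds
divisorTuples-positive {ds = []}    []           _  = []
divisorTuples-positive {ds = _ ∷ _} {m ∷ ms} (m>0 ∷ ms>0) d∈ with d∣m , ds∈ms ← ∈-divisorTuples⁻ m ms d∈ =
  >-nonZero⁻¹ _ {{∣-nonZero {{>-nonZero m>0}} d∣m}} ∷ divisorTuples-positive ms>0 ds∈ms

lcmVec∣prodVec : ∀ (ds : Vec ℕ r) → lcmVec ds ∣ prodVec ds
lcmVec∣prodVec []       = ∣-refl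
lcmVec∣prodVec (d ∷ ds) = lcm-least {d} (m∣m*n (prodVec ds)) (∣-trans (lcmVec∣prodVec ds) (n∣m*n d))

lcmVec-positive : ∀ {ds : Vec ℕ r} → Positive ds → NonZero (lcmVec ds)
lcmVec-positive {ds = ds} ds>0 = ∣-nonZero {{prodVec-positive ds>0}} (lcmVec∣prodVec ds)

-- Behaviour on products of coprime arguments

-- Multiplication is a bijection from pairs (d, e) with d ∣ m and e ∣ n onto the divisors of m * n.
-- If a * b ≡ a′ * b′, then a is coprime to b′ and so divides a′; the other divisibilities are
-- symmetric.
∑-divisors-* : ∀ {m n} {{_ : NonZero m}} {{_ : NonZero n}} → Coprime m n → (f : ℕ → ℕ) →
  ∑ (divisors (m * n)) f ≡ ∑ (divisors m) (λ d → ∑ (divisors n) (λ e → f (d * e)))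
∑-divisors-* {m} {n} co f = begin
  ∑ (divisors (m * n)) f                                ≡⟨ ∑-↭ f divisors↭ ⟩
  ∑ (map (uncurry _*_) pairs) f                         ≡⟨ ∑-map f (uncurry _*_) pairs ⟩
  ∑ pairs (f ∘ uncurry _*_)                             ≡⟨ ∑-cartesianProductWith (f ∘ uncurry _*_) _,_ (divisors m) (divisors n) ⟩
  ∑ (divisors m) (λ d → ∑ (divisors n) (λ e → f (d * e))) ∎
  where
  pairs : List (ℕ × ℕ)
  pairs = cartesianProduct (divisors m) (divisors n)
  instance _ = m*n≢0 m n
  coprime-parts : ∀ {a b} → a ∣ m → b ∣ n → Coprime a b
  coprime-parts a∣m b∣n = coprime-∣ a∣m b∣n co
  first-∣ : ∀ a b a′ b′ → a ∣ m → b′ ∣ n → a * b ≡ a′ * b′ → a ∣ a′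
  first-∣ a b a′ b′ a∣m b′∣n eq =
    coprime-divisor (coprime-parts a∣m b′∣n) (subst (a ∣_) (trans eq (*-comm a′ b′)) (m∣m*n b))
  second-∣ : ∀ a b a′ b′ → a′ ∣ m → b ∣ n → a * b ≡ a′ * b′ → b ∣ b′
  second-∣ a b a′ b′ a′∣m b∣n eq =
    coprime-divisor (Coprimality.sym (coprime-parts a′∣m b∣n)) (subst (b ∣_) eq (n∣m*n a))
  injective : ∀ {x y} → x ∈ pairs → y ∈ pairs → uncurry _*_ x ≡ uncurry _*_ y → x ≡ y
  injective {a , b} {a′ , b′} x∈ y∈ eq
    with a∈ , b∈ ← ∈-cartesianProduct⁻ (divisors m) (divisors n) x∈
    with a′∈ , b′∈ ← ∈-cartesianProduct⁻ (divisors m) (divisors n) y∈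
    with a∣m ← ∈-divisors⁻ m a∈ | b∣n ← ∈-divisors⁻ n b∈ | a′∣m ← ∈-divisors⁻ m a′∈ | b′∣n ← ∈-divisors⁻ n b′∈
    = cong₂ _,_ (∣-antisym (first-∣ a b a′ b′ a∣m b′∣n eq) (first-∣ a′ b′ a b a′∣m b∣n (sym eq)))
                (∣-antisym (second-∣ a b a′ b′ a′∣m b∣n eq) (second-∣ a′ b′ a b a∣m b′∣n (sym eq)))
  to : ∀ {z} → z ∈ divisors (m * n) → z ∈ map (uncurry _*_) pairs
  to {z} z∈ with ∈-divisors⁻ (m * n) z∈
  ... | z∣mn with z′ , m′ , z≡ , m≡ , z′⊥m′ ← gcd-decomposition z m {{∣-nonZero z∣mn}} =
    subst (_∈ map (uncurry _*_) pairs) (sym z≡)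
      (∈-map⁺ (uncurry _*_) (∈-cartesianProduct⁺ (∈-divisors⁺ (gcd[m,n]∣n z m)) (∈-divisors⁺ z′∣n)))
    where
    g : ℕ
    g = gcd z m
    instance
      g≢0 : NonZero g
      g≢0 = ∣-nonZero (gcd[m,n]∣n z m)
    gz′∣gm′n : g * z′ ∣ g * (m′ * n)
    gz′∣gm′n = subst₂ _∣_ z≡ (trans (cong (_* n) m≡) (*-assoc g m′ n)) z∣mn
    z′∣n : z′ ∣ n
    z′∣n = coprime-divisor z′⊥m′ (*-cancelˡ-∣ g gz′∣gm′n)
  from : ∀ {z} → z ∈ map (uncurry _*_) pairs → z ∈ divisors (m * n)
  from z∈
    with _ , x∈ , refl ← ∈-map⁻ (uncurry _*_) {xs = pairs} z∈
    with a∈ , b∈ ← ∈-cartesianProduct⁻ (divisors m) (divisors n) x∈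
    = ∈-divisors⁺ (*-pres-∣ (∈-divisors⁻ m a∈) (∈-divisors⁻ n b∈))
  divisors↭ : divisors (m * n) ↭ map (uncurry _*_) pairs
  divisors↭ = unique∧sameMembers⇒↭ (divisors-unique (m * n))
    (map-unique (uncurry _*_) injective (Unique.cartesianProduct⁺ (divisors-unique m) (divisors-unique n)))
    to from

coprime-heads : ∀ {m n} (ms ns : Vec ℕ r) → Coprime (prodVec (m ∷ ms)) (prodVec (n ∷ ns)) → Coprime m n
coprime-heads ms ns = coprime-∣ (m∣m*n (prodVec ms)) (m∣m*n (prodVec ns))

coprime-tails : ∀ m n {ms ns : Vec ℕ r} → Coprime (prodVec (m ∷ ms)) (prodVec (n ∷ ns)) →
  Coprime (prodVec ms) (prodVec ns)
coprime-tails m n = coprime-∣ (n∣m*n m) (n∣m*n n)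

∑-divisorTuples-* : ∀ {ms ns : Vec ℕ r} → Positive ms → Positive ns → Coprime (prodVec ms) (prodVec ns) →
  (f : Vec ℕ r → ℕ) →
  ∑ (divisorTuples (zipWith _*_ ms ns)) f ≡
  ∑ (divisorTuples ms) (λ ds → ∑ (divisorTuples ns) (λ es → f (zipWith _*_ ds es)))
∑-divisorTuples-* []         []          co f = sym (+-identityʳ (f [] + 0))
∑-divisorTuples-* {ms = m ∷ ms} {n ∷ ns} (m>0 ∷ ms>0) (n>0 ∷ ns>0) co f = begin
  ∑ (divisorTuples (m * n ∷ zipWith _*_ ms ns)) f
    ≡⟨ ∑-tuples f (divisors (m * n)) (Vec.map divisors (zipWith _*_ ms ns)) ⟩
  ∑ (divisors (m * n)) (λ k → ∑ (divisorTuples (zipWith _*_ ms ns)) (λ ks → f (k ∷ ks)))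
    ≡⟨ ∑-divisors-* {m} {n} {{>-nonZero m>0}} {{>-nonZero n>0}} (coprime-heads ms ns co) _ ⟩
  ∑ (divisors m) (λ d → ∑ (divisors n) (λ e → ∑ (divisorTuples (zipWith _*_ ms ns)) (λ ks → f (d * e ∷ ks))))
    -- The recursion sums in the order d, e, ds, es; exchanging e with ds brings d next to ds and e
    -- next to es.
    ≡⟨ ∑-cong (divisors m) (λ d _ → trans
         (∑-cong (divisors n) (λ e _ → ∑-divisorTuples-* ms>0 ns>0 (coprime-tails m n {ms} {ns} co) (λ ks → f (d * e ∷ ks))))
         (∑-swap _ (divisors n) (divisorTuples ms))) ⟩
  ∑ (divisors m) (λ d → ∑ (divisorTuples ms) (λ ds → ∑ (divisors n) (λ e → ∑ (divisorTuples ns) (λ es → f (d * e ∷ zipWith _*_ ds es)))))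
    ≡⟨ ∑-cong (divisors m) (λ d _ → ∑-cong (divisorTuples ms) (λ ds _ →
         ∑-tuples (λ es → f (zipWith _*_ (d ∷ ds) es)) (divisors n) (Vec.map divisors ns))) ⟨
  ∑ (divisors m) (λ d → ∑ (divisorTuples ms) (λ ds → ∑ (divisorTuples (n ∷ ns)) (λ es → f (zipWith _*_ (d ∷ ds) es))))
    ≡⟨ ∑-tuples _ (divisors m) (Vec.map divisors ms) ⟨
  ∑ (divisorTuples (m ∷ ms)) (λ ds → ∑ (divisorTuples (n ∷ ns)) (λ es → f (zipWith _*_ ds es))) ∎

-- By antisymmetry. For the harder direction, lcm d D and lcm e E are coprime because they divide
-- the two coprime products; each divides the left side, hence so does their product.
lcmVec-* : ∀ (ds es : Vec ℕ r) → Coprime (prodVec ds) (prodVec es) →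
  lcmVec (zipWith _*_ ds es) ≡ lcmVec ds * lcmVec es
lcmVec-* []       []       co = refl
lcmVec-* (d ∷ ds) (e ∷ es) co = begin
  lcm (d * e) (lcmVec (zipWith _*_ ds es)) ≡⟨ cong (lcm (d * e)) (lcmVec-* ds es (coprime-tails d e {ds} {es} co)) ⟩
  lcm (d * e) (D * E)                      ≡⟨ ∣-antisym
    (lcm-least (*-pres-∣ (m∣lcm[m,n] d D) (m∣lcm[m,n] e E)) (*-pres-∣ (n∣lcm[m,n] d D) (n∣lcm[m,n] e E)))
    (coprime-*-∣ (coprime-∣ (lcmVec∣prodVec (d ∷ ds)) (lcmVec∣prodVec (e ∷ es)) co)
      (lcm-least (m*n∣⇒m∣ d e (m∣lcm[m,n] (d * e) (D * E))) (m*n∣⇒m∣ D E (n∣lcm[m,n] (d * e) (D * E))))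
      (lcm-least (m*n∣⇒n∣ d e (m∣lcm[m,n] (d * e) (D * E))) (m*n∣⇒n∣ D E (n∣lcm[m,n] (d * e) (D * E))))) ⟩
  lcm d D * lcm e E                        ∎
  where
  D E : ℕ
  D = lcmVec ds
  E = lcmVec es

prodVec-φ-* : ∀ {ds es : Vec ℕ r} → Positive ds → Coprime (prodVec ds) (prodVec es) →
  prodVec (Vec.map φ (zipWith _*_ ds es)) ≡ prodVec (Vec.map φ ds) * prodVec (Vec.map φ es)
prodVec-φ-* {ds = []}     {[]}     []           co = refl
prodVec-φ-* {ds = d ∷ ds} {e ∷ es} (d>0 ∷ ds>0) co = begin
  φ (d * e) * prodVec (Vec.map φ (zipWith _*_ ds es)) ≡⟨ cong₂ _*_
      (φ-*-coprime {{>-nonZero d>0}} (coprime-heads ds es co))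
      (prodVec-φ-* ds>0 (coprime-tails d e {ds} {es} co)) ⟩
  φ d * φ e * (prodVec (Vec.map φ ds) * prodVec (Vec.map φ es)) ≡⟨ interchange (φ d) (φ e) _ _ ⟩
  φ d * prodVec (Vec.map φ ds) * (φ e * prodVec (Vec.map φ es)) ∎
  where
  interchange : ∀ a b x y → a * b * (x * y) ≡ a * x * (b * y)
  interchange = solve-∀

-- Divisors of prime powers

-- If p ∤ d, then d is coprime to p and already divides the smaller power; otherwise one factor p is
-- cancelled. The bound is `i < suc n` to match membership in `upTo (suc n)`.
∣-prime-^ : ∀ {p d} n → Prime p → d ∣ p ^ n → ∃ λ i → i < suc n × d ≡ p ^ i
∣-prime-^ zero    pp d∣1 = 0 , s≤s z≤n , ∣1⇒≡1 d∣1
∣-prime-^ {p} {d} (suc n) pp d∣ with p ∣? d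
... | no  p∤d with i , i≤n , d≡ ← ∣-prime-^ n pp (coprime-divisor (Coprimality.sym (prime∤⇒coprime pp p∤d)) d∣) =
  i , m<n⇒m<1+n i≤n , d≡
... | yes (divides q refl) with i , i≤n , q≡ ← ∣-prime-^ n pp (*-cancelˡ-∣ p {{prime⇒nonZero pp}} (subst (_∣ p * p ^ n) (*-comm q p) d∣)) =
  suc i , s≤s i≤n , trans (*-comm q p) (cong (p *_) q≡)

m≤n⇒p^m∣p^n : ∀ p {m n} → m ≤ n → p ^ m ∣ p ^ n
m≤n⇒p^m∣p^n p {m} {n} m≤n = subst (λ k → p ^ m ∣ p ^ k) (m+[n∸m]≡n m≤n)
  (subst (p ^ m ∣_) (sym (^-distribˡ-+-* p m (n ∸ m))) (m∣m*n (p ^ (n ∸ m))))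

∑-divisors-^ : ∀ {p} n → Prime p → (f : ℕ → ℕ) → ∑ (divisors (p ^ n)) f ≡ ∑< (suc n) (λ i → f (p ^ i))
∑-divisors-^ {p} n pp f = trans (∑-↭ f divisors↭) (∑-map f (p ^_) (upTo (suc n)))
  where
  instance
    p≢0 : NonZero p
    p≢0 = prime⇒nonZero pp
    pⁿ≢0 : NonZero (p ^ n)
    pⁿ≢0 = m^n≢0 p n
  1<p : 1 < p
  1<p = nonTrivial⇒n>1 p {{prime⇒nonTrivial pp}}
  to : ∀ {z} → z ∈ divisors (p ^ n) → z ∈ map (p ^_) (upTo (suc n))
  to z∈ with i , i≤n , refl ← ∣-prime-^ n pp (∈-divisors⁻ (p ^ n) z∈) = ∈-map⁺ (p ^_) (∈-upTo⁺ i≤n)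
  from : ∀ {z} → z ∈ map (p ^_) (upTo (suc n)) → z ∈ divisors (p ^ n)
  from z∈ with i , i∈ , refl ← ∈-map⁻ (p ^_) z∈ =
    ∈-divisors⁺ (m≤n⇒p^m∣p^n p (≤-pred (∈-upTo⁻ i∈)))
  divisors↭ : divisors (p ^ n) ↭ map (p ^_) (upTo (suc n))
  divisors↭ = unique∧sameMembers⇒↭ (divisors-unique (p ^ n)) (Unique.map⁺ (λ {i} {j} → ^-injective i j) (Unique.upTo⁺ (suc n))) to from
    where
    ^-injective : ∀ i j → p ^ i ≡ p ^ j → i ≡ j
    ^-injective i j eq with <-cmp i j
    ... | tri< i<j _ _ = ⊥-elim (<⇒≢ (^-monoʳ-< p 1<p i<j) eq)
    ... | tri≈ _ i≡j _ = i≡j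
    ... | tri> _ _ j<i = ⊥-elim (<⇒≢ (^-monoʳ-< p 1<p j<i) (sym eq))

-- Congruences

m≤n⇒m+∣m-n∣≡n : ∀ {m n} → m ≤ n → m + ∣ m - n ∣ ≡ n
m≤n⇒m+∣m-n∣≡n {m} m≤n = trans (cong (m +_) (m≤n⇒∣m-n∣≡n∸m m≤n)) (m+[n∸m]≡n m≤n)

-- Congruence of a and b modulo d is expressed as d ∣ ∣ a - b ∣, which stays in ℕ and does not
-- depend on which number is larger.
∣-resp-≡mod : ∀ {d a b} → d ∣ ∣ a - b ∣ → d ∣ a → d ∣ b
∣-resp-≡mod {d} {a} {b} d∣a-b d∣a with ≤-total a b
... | inj₁ a≤b = subst (d ∣_) (m≤n⇒m+∣m-n∣≡n a≤b) (∣m∣n⇒∣m+n d∣a d∣a-b)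
... | inj₂ b≤a = ∣m+n∣m⇒∣n
  (subst (d ∣_) (trans (sym (m≤n⇒m+∣m-n∣≡n b≤a)) (+-comm b ∣ b - a ∣)) d∣a)
  (subst (d ∣_) (∣-∣-comm a b) d∣a-b)

-- The convention `modN a 0 = a` agrees with congruence modulo 0, which is equality, so modulus 0
-- fits the same equivalence.
modN-≡⇒∣ : ∀ m {a b} → modN a m ≡ modN b m → m ∣ ∣ a - b ∣
modN-≡⇒∣ zero      {a}     refl = subst (0 ∣_) (sym (∣n-n∣≡0 a)) (0 ∣0)
modN-≡⇒∣ m@(suc _) {a} {b} eq = subst (m ∣_) (sym difference) (n∣m*n ∣ a ℕ./ m - b ℕ./ m ∣)
  where
  difference : ∣ a - b ∣ ≡ ∣ a ℕ./ m - b ℕ./ m ∣ * m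
  difference = begin
    ∣ a - b ∣                                          ≡⟨ cong₂ ∣_-_∣ (m≡m%n+[m/n]*n a m) (m≡m%n+[m/n]*n b m) ⟩
    ∣ a % m + a ℕ./ m * m - b % m + b ℕ./ m * m ∣          ≡⟨ cong (λ u → ∣ a % m + a ℕ./ m * m - u + b ℕ./ m * m ∣) (sym eq) ⟩
    ∣ a % m + a ℕ./ m * m - a % m + b ℕ./ m * m ∣          ≡⟨ ∣m+n-m+o∣≡∣n-o∣ (a % m) _ _ ⟩
    ∣ a ℕ./ m * m - b ℕ./ m * m ∣                          ≡⟨ *-distribʳ-∣-∣ m (a ℕ./ m) (b ℕ./ m) ⟨
    ∣ a ℕ./ m - b ℕ./ m ∣ * m                              ∎

∣⇒modN-≡ : ∀ m {a b} → m ∣ ∣ a - b ∣ → modN a m ≡ modN b m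
∣⇒modN-≡ zero    0∣a-b = ∣m-n∣≡0⇒m≡n (0∣⇒≡0 0∣a-b)
∣⇒modN-≡ m@(suc _) {a} {b} m∣a-b with ≤-total a b
... | inj₁ a≤b = sym (trans (cong (_% m) (sym (m≤n⇒m+∣m-n∣≡n a≤b))) (%-remove-+ʳ a m∣a-b))
... | inj₂ b≤a = trans (cong (_% m) (sym (m≤n⇒m+∣m-n∣≡n b≤a))) (%-remove-+ʳ b (subst (m ∣_) (∣-∣-comm a b) m∣a-b))

modN-idem : ∀ m a → modN (modN a m) m ≡ modN a m
modN-idem zero      a = refl
modN-idem m@(suc _) a = m%n%n≡m%n a m

modN-∣ : ∀ m a → m ∣ ∣ modN a m - a ∣
modN-∣ m a = modN-≡⇒∣ m (modN-idem m a)

modN-+ : ∀ m x a → modN (x + modN a m) m ≡ modN (x + a) m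
modN-+ m x a = ∣⇒modN-≡ m (subst (m ∣_) (sym (∣m+n-m+o∣≡∣n-o∣ x _ _)) (modN-∣ m a))

modN-* : ∀ m k a → m ∣ ∣ k * modN a m - k * a ∣
modN-* m k a = subst (m ∣_) (*-distribˡ-∣-∣ k _ _) (∣n⇒∣m*n k (modN-∣ m a))

modN-< : ∀ {m} a → 0 < m → modN a m < m
modN-< {suc m} a _ = m%n<n a (suc m)

modN-small : ∀ {m a} → a < m → modN a m ≡ a
modN-small {suc m} a<m = m<n⇒m%n≡m a<m

n∣∣k%n-k∣ : ∀ k n {{_ : NonZero n}} → n ∣ ∣ k % n - k ∣
n∣∣k%n-k∣ k n@(suc _) = modN-∣ n k

residues-≡ : ∀ {n k j} → k < n → j < n → n ∣ ∣ k - j ∣ → k ≡ j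
residues-≡ {n} {k} {j} k<n j<n n∣ = trans (sym (modN-small k<n)) (trans (∣⇒modN-≡ n n∣) (modN-small j<n))

unit⇒invertible : ∀ {k n} → Coprime k n → ∃ λ j → n ∣ ∣ j * k - 1 ∣
unit⇒invertible {k} {n} co with coprime-Bézout co
-- Here 1 + y * n ≡ x * k, so x itself is the inverse.
... | Bézout.Identity.+- x y eq = x , subst (n ∣_) (sym difference) (n∣m*n y)
  where
  difference : ∣ x * k - 1 ∣ ≡ y * n
  difference = trans (cong (λ u → ∣ u - 1 ∣) (sym eq)) (∣-∣-identityʳ (y * n))
-- Here x * k ≡ −1, so the inverse is −x, and −x ≡ x * k * x.
... | Bézout.Identity.-+ x y eq = x * k * x , subst (λ u → n ∣ ∣ u - 1 ∣) (sym (*-assoc (x * k) x k))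
        (∣-trans (subst (n ∣_) (sym eq) (n∣m*n y)) (1+a∣∣a²-1∣ (x * k)))
  where
  1+a∣∣a²-1∣ : ∀ a → 1 + a ∣ ∣ a * a - 1 ∣
  1+a∣∣a²-1∣ zero    = ∣-refl
  1+a∣∣a²-1∣ (suc b) = divides b (trans (∣-∣-identityʳ _) (square b))
    where
    square : ∀ b → b + b * suc b ≡ b * suc (suc b)
    square = solve-∀

invertible⇒unit : ∀ {j k n} → n ∣ ∣ j * k - 1 ∣ → Coprime k n
invertible⇒unit {j} n∣ (d∣k , d∣n) = ∣1⇒≡1 (∣-resp-≡mod (∣-trans d∣n n∣) (∣n⇒∣m*n j d∣k))

-- Orders of elements of ℤ/m

-- The value m / gcd m x. That it is the additive order is the pair `∣*⇒order∣` and `order∣⇒∣*`: m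
-- divides k * x exactly when it divides k.
order : ℕ → ℕ → ℕ
order m x = quotient (gcd[m,n]∣m m x)

order∣ : ∀ m x → order m x ∣ m
order∣ m x = quotient-∣ (gcd[m,n]∣m m x)

order-decomposition : ∀ m x {{_ : NonZero m}} → ∃ λ x′ →
  m ≡ gcd m x * order m x × x ≡ gcd m x * x′ × Coprime (order m x) x′
order-decomposition m x = proj₂ (gcd-decomposition m x)

∣*⇒order∣ : ∀ m x k {{_ : NonZero m}} → m ∣ k * x → order m x ∣ k
∣*⇒order∣ m x k m∣kx with x′ , m≡ , x≡ , co ← order-decomposition m x =
  coprime-divisor co (subst (order m x ∣_) (*-comm k x′) (*-cancelˡ-∣ g {{∣-nonZero (gcd[m,n]∣m m x)}} gd∣gkx′))
  where
  g : ℕ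
  g = gcd m x
  left-commute : ∀ k g x′ → k * (g * x′) ≡ g * (k * x′)
  left-commute = solve-∀
  gd∣gkx′ : g * order m x ∣ g * (k * x′)
  gd∣gkx′ = subst₂ _∣_ m≡ (trans (cong (k *_) x≡) (left-commute k g x′)) m∣kx

order∣⇒∣* : ∀ m x k {{_ : NonZero m}} → order m x ∣ k → m ∣ k * x
order∣⇒∣* m x k o∣k with x′ , m≡ , x≡ , _ ← order-decomposition m x =
  subst₂ _∣_ (trans (*-comm (order m x) _) (sym m≡)) (cong (k *_) (sym x≡)) (*-pres-∣ o∣k (m∣m*n {gcd m x} x′))

-- With q = m / d, order d means gcd m x = q. Such x are multiples y * q with y < d, and gcd m (y *
-- q) = q * gcd y d, so the condition becomes that y is coprime to d.
order-count : ∀ {m d} {{_ : NonZero m}} → d ∣ m → ∑< m (λ x → ⟦ order m x ≟ d ⟧) ≡ φ d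
order-count {m} {d} (divides q m≡qd) = begin
  ∑< m (λ x → ⟦ order m x ≟ d ⟧)                        ≡⟨ ∑<-cong m (λ x _ → indicator x) ⟩
  -- The first factor is implied by the second; it is written out so that the sum can be restricted
  -- to multiples of q.
  ∑< m (λ x → ⟦ q ∣? x ⟧ * ⟦ gcd m x ≟ q ⟧)             ≡⟨ cong (λ N → ∑< N (λ x → ⟦ q ∣? x ⟧ * ⟦ gcd m x ≟ q ⟧)) m≡dq ⟩
  ∑< (d * q) (λ x → ⟦ q ∣? x ⟧ * ⟦ gcd m x ≟ q ⟧)       ≡⟨ ∑-multiples d q (λ x → ⟦ gcd m x ≟ q ⟧) ⟩
  ∑< d (λ y → ⟦ gcd m (y * q) ≟ q ⟧)                    ≡⟨ ∑<-cong d (λ y _ → reduce y) ⟩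
  ∑< d (coprimeTo d)                                    ≡⟨ φ≡∑ d ⟨
  φ d                                                   ∎
  where
  m≡dq : m ≡ d * q
  m≡dq = trans m≡qd (*-comm q d)
  instance
    d≢0 : NonZero d
    d≢0 = ∣-nonZero (divides q m≡qd)
    q≢0 : NonZero q
    q≢0 = ∣-nonZero (divides d m≡dq)
  m≡gcd*order : ∀ x → m ≡ gcd m x * order m x
  m≡gcd*order x = m∣n⇒n≡m*quotient (gcd[m,n]∣m m x)
  order≡⇒gcd≡ : ∀ x → order m x ≡ d → gcd m x ≡ q
  order≡⇒gcd≡ x refl = *-cancelʳ-≡ _ q d (trans (sym (m≡gcd*order x)) m≡qd)
  gcd≡⇒order≡ : ∀ x → gcd m x ≡ q → order m x ≡ d
  gcd≡⇒order≡ x eq = *-cancelˡ-≡ _ d q (trans (cong (_* order m x) (sym eq)) (trans (sym (m≡gcd*order x)) m≡qd))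
  indicator : ∀ x → ⟦ order m x ≟ d ⟧ ≡ ⟦ q ∣? x ⟧ * ⟦ gcd m x ≟ q ⟧
  indicator x = trans
    (⟦⟧-cong (order m x ≟ d) (q ∣? x ×-dec gcd m x ≟ q)
      (λ o≡d → subst (_∣ x) (order≡⇒gcd≡ x o≡d) (gcd[m,n]∣n m x) , order≡⇒gcd≡ x o≡d)
      (gcd≡⇒order≡ x ∘ proj₂))
    (⟦⟧-× (q ∣? x) (gcd m x ≟ q))
  gcd-scaled : ∀ y → gcd m (y * q) ≡ q * gcd y d
  gcd-scaled y = begin
    gcd m (y * q)       ≡⟨ cong₂ gcd m≡qd (*-comm y q) ⟩
    gcd (q * d) (q * y) ≡⟨ c*gcd[m,n]≡gcd[cm,cn] q d y ⟨
    q * gcd d y         ≡⟨ cong (q *_) (gcd-comm d y) ⟩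
    q * gcd y d         ∎
  reduce : ∀ y → ⟦ gcd m (y * q) ≟ q ⟧ ≡ coprimeTo d y
  reduce y = ⟦⟧-cong (gcd m (y * q) ≟ q) (gcd y d ≟ 1)
    (λ eq → *-cancelˡ-≡ _ 1 q (trans (sym (gcd-scaled y)) (trans eq (sym (*-identityʳ q)))))
    (λ eq → trans (gcd-scaled y) (trans (cong (q *_) eq) (*-identityʳ q)))

_≟ᵛ_ : DecidableEquality (Vec ℕ r)
_≟ᵛ_ = VecP.≡-dec _≟_

orders : Vec ℕ r → Vec ℕ r → Vec ℕ r
orders = zipWith order

orders∈divisorTuples : ∀ {ms : Vec ℕ r} → Positive ms → ∀ x → orders ms x ∈ divisorTuples ms
orders∈divisorTuples []           []       = here refl
orders∈divisorTuples {ms = m ∷ ms} (m>0 ∷ ms>0) (x ∷ xs) =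
  ∈-tuples⁺ {Ls = Vec.map divisors ms} (∈-divisors⁺ {{>-nonZero m>0}} (order∣ m x)) (orders∈divisorTuples ms>0 xs)

orders-count : ∀ {ms ds : Vec ℕ r} → Positive ms → ds ∈ divisorTuples ms →
  ∑ (elems ms) (λ x → ⟦ orders ms x ≟ᵛ ds ⟧) ≡ prodVec (Vec.map φ ds)
orders-count {ds = []}     []           _  = refl
orders-count {ms = m ∷ ms} {d ∷ ds} (m>0 ∷ ms>0) d∷ds∈ with d∣m , ds∈ ← ∈-divisorTuples⁻ m ms d∷ds∈ = begin
  ∑ (elems (m ∷ ms)) (λ x → ⟦ orders (m ∷ ms) x ≟ᵛ (d ∷ ds) ⟧)
    ≡⟨ ∑-tuples (λ x → ⟦ orders (m ∷ ms) x ≟ᵛ (d ∷ ds) ⟧) (upTo m) (Vec.map upTo ms) ⟩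
  ∑< m (λ x → ∑ (elems ms) (λ xs → ⟦ (order m x ∷ orders ms xs) ≟ᵛ (d ∷ ds) ⟧))
    ≡⟨ ∑<-cong m (λ x _ → ∑-cong (elems ms) (λ xs _ → indicator x xs)) ⟩
  ∑< m (λ x → ∑ (elems ms) (λ xs → ⟦ order m x ≟ d ⟧ * ⟦ orders ms xs ≟ᵛ ds ⟧))
    ≡⟨ ∑-× (λ x → ⟦ order m x ≟ d ⟧) (λ xs → ⟦ orders ms xs ≟ᵛ ds ⟧) (upTo m) (elems ms) ⟩
  ∑< m (λ x → ⟦ order m x ≟ d ⟧) * ∑ (elems ms) (λ xs → ⟦ orders ms xs ≟ᵛ ds ⟧)
    ≡⟨ cong₂ _*_ (order-count {{>-nonZero m>0}} d∣m) (orders-count ms>0 ds∈) ⟩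
  φ d * prodVec (Vec.map φ ds) ∎
  where
  indicator : ∀ x xs → ⟦ (order m x ∷ orders ms xs) ≟ᵛ (d ∷ ds) ⟧ ≡ ⟦ order m x ≟ d ⟧ * ⟦ orders ms xs ≟ᵛ ds ⟧
  indicator x xs = trans
    (⟦⟧-cong ((order m x ∷ orders ms xs) ≟ᵛ (d ∷ ds)) (order m x ≟ d ×-dec orders ms xs ≟ᵛ ds)
      VecP.∷-injective (uncurry (cong₂ _∷_)))
    (⟦⟧-× (order m x ≟ d) (orders ms xs ≟ᵛ ds))

-- Powers

pow-∷ : ∀ m (ms : Vec ℕ r) k x xs → pow (m ∷ ms) k (x ∷ xs) ≡ modN (k * x) m ∷ pow ms k xs
-- Both zeroth-power cases read 0 ≡ modN 0 m, and `modN` computes only once the modulus is matched.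
pow-∷ zero    ms zero    x xs = refl
pow-∷ (suc _) ms zero    x xs = refl
pow-∷ m       ms (suc k) x xs = begin
  op (m ∷ ms) (x ∷ xs) (pow (m ∷ ms) k (x ∷ xs))              ≡⟨ cong (op (m ∷ ms) (x ∷ xs)) (pow-∷ m ms k x xs) ⟩
  modN (x + modN (k * x) m) m ∷ op ms xs (pow ms k xs)        ≡⟨ cong (_∷ op ms xs (pow ms k xs)) (modN-+ m x (k * x)) ⟩
  modN (x + k * x) m ∷ op ms xs (pow ms k xs)                 ∎

-- With its converse `∣⇒pow-≡`, this says that the order of x is the lcm of the orders of its
-- coordinates.
pow-≡⇒∣ : ∀ {ms : Vec ℕ r} → Positive ms → ∀ x k j → pow ms k x ≡ pow ms j x → lcmVec (orders ms x) ∣ ∣ k - j ∣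
pow-≡⇒∣ []           []       k j eq = 1∣ _
pow-≡⇒∣ {ms = m ∷ ms} (m>0 ∷ ms>0) (x ∷ xs) k j eq
  with eq₁ , eq₂ ← VecP.∷-injective (trans (sym (pow-∷ m ms k x xs)) (trans eq (pow-∷ m ms j x xs))) =
  lcm-least (∣*⇒order∣ m x _ {{>-nonZero m>0}} (subst (m ∣_) (sym (*-distribʳ-∣-∣ x k j)) (modN-≡⇒∣ m eq₁)))
            (pow-≡⇒∣ ms>0 xs k j eq₂)

∣⇒pow-≡ : ∀ {ms : Vec ℕ r} → Positive ms → ∀ x k j → lcmVec (orders ms x) ∣ ∣ k - j ∣ → pow ms k x ≡ pow ms j x
∣⇒pow-≡ {ms = []}     []           []       k j _  with pow [] k [] | pow [] j []
... | [] | [] = refl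
∣⇒pow-≡ {ms = m ∷ ms} (m>0 ∷ ms>0) (x ∷ xs) k j L∣ = begin
  pow (m ∷ ms) k (x ∷ xs)       ≡⟨ pow-∷ m ms k x xs ⟩
  modN (k * x) m ∷ pow ms k xs  ≡⟨ cong₂ _∷_
     (∣⇒modN-≡ m (subst (m ∣_) (*-distribʳ-∣-∣ x k j)
       (order∣⇒∣* m x _ {{>-nonZero m>0}} (∣-trans (m∣lcm[m,n] (order m x) (lcmVec (orders ms xs))) L∣))))
     (∣⇒pow-≡ ms>0 xs k j (∣-trans (n∣lcm[m,n] (order m x) (lcmVec (orders ms xs))) L∣)) ⟩
  modN (j * x) m ∷ pow ms j xs  ≡⟨ pow-∷ m ms j x xs ⟨
  pow (m ∷ ms) j (x ∷ xs)       ∎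

pow-pow : ∀ (ms : Vec ℕ r) j k x → pow ms j (pow ms k x) ≡ pow ms (j * k) x
pow-pow []       j k []       with pow [] j (pow [] k []) | pow [] (j * k) []
... | [] | [] = refl
pow-pow (m ∷ ms) j k (x ∷ xs) = begin
  pow (m ∷ ms) j (pow (m ∷ ms) k (x ∷ xs))                  ≡⟨ cong (pow (m ∷ ms) j) (pow-∷ m ms k x xs) ⟩
  pow (m ∷ ms) j (modN (k * x) m ∷ pow ms k xs)             ≡⟨ pow-∷ m ms j _ _ ⟩
  modN (j * modN (k * x) m) m ∷ pow ms j (pow ms k xs)      ≡⟨ cong₂ _∷_
     (trans (∣⇒modN-≡ m (modN-* m j (k * x))) (cong (λ a → modN a m) (sym (*-assoc j k x)))) (pow-pow ms j k xs) ⟩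
  modN (j * k * x) m ∷ pow ms (j * k) xs                    ≡⟨ pow-∷ m ms (j * k) x xs ⟨
  pow (m ∷ ms) (j * k) (x ∷ xs)                             ∎

pow∈elems : ∀ {ms : Vec ℕ r} → Positive ms → ∀ k x → pow ms k x ∈ elems ms
pow∈elems []           k []       with pow [] k []
... | [] = here refl
pow∈elems {ms = m ∷ ms} (m>0 ∷ ms>0) k (x ∷ xs) = subst (_∈ elems (m ∷ ms)) (sym (pow-∷ m ms k x xs))
  (∈-tuples⁺ {Ls = Vec.map upTo ms} (∈-upTo⁺ (modN-< (k * x) m>0)) (pow∈elems ms>0 k xs))

pow-1 : ∀ {ms x : Vec ℕ r} → x ∈ elems ms → pow ms 1 x ≡ x
pow-1 {ms = []}     {[]}     _  = refl
pow-1 {ms = m ∷ ms} {x ∷ xs} x∈ with x<m , xs∈ ← ∈-tuples⁻ (upTo m) (Vec.map upTo ms) x∈ =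
  trans (pow-∷ m ms 1 x xs) (cong₂ _∷_
    (trans (cong (λ a → modN a m) (*-identityˡ x)) (modN-small (∈-upTo⁻ x<m))) (pow-1 xs∈))

-- The order of x also annihilates every multiple k * x, and reduction modulo m does not change
-- this.
order-pow-∣ : ∀ m x k {{_ : NonZero m}} → order m (modN (k * x) m) ∣ order m x
order-pow-∣ m x k = ∣*⇒order∣ m _ (order m x)
  (∣-resp-≡mod (subst (m ∣_) (∣-∣-comm (order m x * modN (k * x) m) (order m x * (k * x))) (modN-* m (order m x) (k * x))) m∣okx)
  where
  left-commute : ∀ k o x → k * (o * x) ≡ o * (k * x)
  left-commute = solve-∀
  m∣okx : m ∣ order m x * (k * x)
  m∣okx = subst (m ∣_) (left-commute k (order m x) x) (∣n⇒∣m*n k (order∣⇒∣* m x (order m x) ∣-refl))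

-- In each coordinate x and y are multiples of each other, so their orders divide each other. Hence
-- the order vector is an invariant of the subgroup.
mutual-powers⇒orders≡ : ∀ {ms x y : Vec ℕ r} → Positive ms → ∀ k j → pow ms k x ≡ y → pow ms j y ≡ x →
  orders ms x ≡ orders ms y
mutual-powers⇒orders≡ {x = []} {[]} []           k j _   _   = refl
mutual-powers⇒orders≡ {ms = m ∷ ms} {x ∷ xs} {y ∷ ys} (m>0 ∷ ms>0) k j x→y y→x
  with kx≡y , kxs≡ys ← VecP.∷-injective (trans (sym (pow-∷ m ms k x xs)) x→y)
  with jy≡x , jys≡xs ← VecP.∷-injective (trans (sym (pow-∷ m ms j y ys)) y→x)
  = cong₂ _∷_ (∣-antisym (subst (λ z → order m z ∣ order m y) jy≡x (order-pow-∣ m y j))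
                         (subst (λ z → order m z ∣ order m x) kx≡y (order-pow-∣ m x k)))
              (mutual-powers⇒orders≡ ms>0 k j kxs≡ys jys≡xs)
  where instance _ = >-nonZero m>0

-- Cyclic subgroups

T-ext : ∀ {a b} → (T a → T b) → (T b → T a) → a ≡ b
T-ext {false} {false} _ _ = refl
T-ext {true}  {true}  _ _ = refl
T-ext {false} {true}  _ g = ⊥-elim (g _)
T-ext {true}  {false} f _ = ⊥-elim (f _)

map-≡-pointwise : ∀ {f g : A → B} {xs z} → map f xs ≡ map g xs → z ∈ xs → f z ≡ g z
map-≡-pointwise eq (here refl) = proj₁ (ListP.∷-injective eq)
map-≡-pointwise eq (there z∈)  = map-≡-pointwise (proj₂ (ListP.∷-injective eq)) z∈

_≟ᵇ_ : DecidableEquality (List Bool)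
_≟ᵇ_ = ListP.≡-dec Bool._≟_

-- Repeats the Boolean test inside `cyclicSubgroup`, so that `cyclicSubgroup ms x` is definitionally
-- `map (inSubgroup ms x) (elems ms)`.
inSubgroup : Vec ℕ r → Vec ℕ r → Vec ℕ r → Bool
inSubgroup ms x y = any (λ k → ⌊ VecP.≡-dec _≟_ (pow ms k x) y ⌋) (upTo (length (elems ms)))

inSubgroup⁻ : ∀ (ms x y : Vec ℕ r) → T (inSubgroup ms x y) → ∃ λ k → pow ms k x ≡ y
inSubgroup⁻ ms x y t with k , t′ ← satisfied (any⁻ _ (upTo (length (elems ms))) t) = k , toWitness t′

-- The test searches only exponents below the group order n. Any k may be replaced by k % n, because
-- the order of x divides the product of its coordinate orders, which divides n.
inSubgroup⁺ : ∀ {ms : Vec ℕ r} → Positive ms → ∀ x y k → pow ms k x ≡ y → T (inSubgroup ms x y)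
inSubgroup⁺ {ms = ms} ms>0 x y k kx≡y = any⁺ _ (lose (∈-upTo⁺ (m%n<n k n)) (fromWitness (trans reduced kx≡y)))
  where
  n : ℕ
  n = length (elems ms)
  instance
    n≢0 : NonZero n
    n≢0 = subst NonZero (sym (length-elems ms)) (prodVec-positive ms>0)
  exponent∣n : lcmVec (orders ms x) ∣ n
  exponent∣n = subst (lcmVec (orders ms x) ∣_) (sym (length-elems ms))
    (∣-trans (lcmVec∣prodVec (orders ms x)) (divisorTuples-prodVec-∣ ms (orders∈divisorTuples ms>0 x)))
  reduced : pow ms (k % n) x ≡ pow ms k x
  reduced = ∣⇒pow-≡ ms>0 x (k % n) k (∣-trans exponent∣n (n∣∣k%n-k∣ k n))

-- Since y = y^1 belongs to its own subgroup, comparing the two characteristic vectors at the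
-- position of y puts y into ⟨x⟩.
cyclicSubgroup-≡⇒power : ∀ {ms x y : Vec ℕ r} → Positive ms → y ∈ elems ms →
  cyclicSubgroup ms x ≡ cyclicSubgroup ms y → ∃ λ k → pow ms k x ≡ y
cyclicSubgroup-≡⇒power {ms = ms} {x} {y} ms>0 y∈ eq = inSubgroup⁻ ms x y
  (subst T (sym (map-≡-pointwise {f = inSubgroup ms x} {inSubgroup ms y} eq y∈)) (inSubgroup⁺ ms>0 y y 1 (pow-1 y∈)))

mutual-powers⇒cyclicSubgroup-≡ : ∀ {ms x y : Vec ℕ r} → Positive ms → ∀ k j → pow ms k x ≡ y → pow ms j y ≡ x →
  cyclicSubgroup ms x ≡ cyclicSubgroup ms y
mutual-powers⇒cyclicSubgroup-≡ {ms = ms} {x} {y} ms>0 k j x→y y→x =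
  ListP.map-cong (λ z → T-ext (transfer x y z j y→x) (transfer y x z k x→y)) (elems ms)
  where
  transfer : ∀ x y z j → pow ms j y ≡ x → T (inSubgroup ms x z) → T (inSubgroup ms y z)
  transfer x y z j y→x t with i , x→z ← inSubgroup⁻ ms x z t = inSubgroup⁺ ms>0 y z (i * j)
    (trans (sym (pow-pow ms i j y)) (trans (cong (pow ms i) y→x) x→z))

-- The generators of ⟨x⟩ are the powers x^k with 0 ≤ k < ord x and k coprime to ord x.
generators-count : ∀ {ms x : Vec ℕ r} → Positive ms → x ∈ elems ms →
  ∑ (elems ms) (λ y → ⟦ cyclicSubgroup ms x ≟ᵇ cyclicSubgroup ms y ⟧) ≡ φ (lcmVec (orders ms x))
generators-count {ms = ms} {x} ms>0 x∈ = begin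
  ∑ (elems ms) (λ y → ⟦ sameSubgroup? y ⟧) ≡⟨ length-filter≡∑ sameSubgroup? (elems ms) ⟨
  length (filter sameSubgroup? (elems ms)) ≡⟨ bijection⇒length≡ (λ k → pow ms k x)
      (Unique.filter⁺ unit? (Unique.upTo⁺ n)) (Unique.filter⁺ sameSubgroup? (elems-unique ms)) injective into onto ⟨
  length (filter unit? (upTo n))           ≡⟨ length-filter≡∑ unit? (upTo n) ⟩
  ∑< n (coprimeTo n)                       ≡⟨ φ≡∑ n ⟨
  φ n                                      ∎
  where
  n : ℕ
  n = lcmVec (orders ms x)
  instance
    n≢0 : NonZero n
    n≢0 = lcmVec-positive (divisorTuples-positive ms>0 (orders∈divisorTuples ms>0 x))
  sameSubgroup? : ∀ y → Dec (cyclicSubgroup ms x ≡ cyclicSubgroup ms y)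
  sameSubgroup? y = cyclicSubgroup ms x ≟ᵇ cyclicSubgroup ms y
  unit? : ∀ k → Dec (gcd k n ≡ 1)
  unit? k = gcd k n ≟ 1
  injective : ∀ {k j} → k ∈ filter unit? (upTo n) → j ∈ filter unit? (upTo n) → pow ms k x ≡ pow ms j x → k ≡ j
  injective {k} {j} k∈ j∈ eq = residues-≡
    (∈-upTo⁻ (proj₁ (∈-filter⁻ unit? {xs = upTo n} k∈))) (∈-upTo⁻ (proj₁ (∈-filter⁻ unit? {xs = upTo n} j∈)))
    (pow-≡⇒∣ ms>0 x k j eq)
  into : ∀ {k} → k ∈ filter unit? (upTo n) → pow ms k x ∈ filter sameSubgroup? (elems ms)
  into {k} k∈
    -- If j inverts k modulo ord x, then (x^k)^j = x, so x and x^k are powers of each other.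
    with j , n∣jk-1 ← unit⇒invertible {k} (gcd≡1⇒coprime (proj₂ (∈-filter⁻ unit? {xs = upTo n} k∈)))
    = ∈-filter⁺ sameSubgroup? (pow∈elems ms>0 k x) (mutual-powers⇒cyclicSubgroup-≡ ms>0 k j refl
        (trans (pow-pow ms j k x) (trans (∣⇒pow-≡ ms>0 x (j * k) 1 n∣jk-1) (pow-1 x∈))))
  onto : ∀ {y} → y ∈ filter sameSubgroup? (elems ms) → ∃ λ k → k ∈ filter unit? (upTo n) × y ≡ pow ms k x
  onto {y} y∈
    with y∈G , eq ← ∈-filter⁻ sameSubgroup? {xs = elems ms} y∈
    with k , x→y ← cyclicSubgroup-≡⇒power ms>0 y∈G eq
    with j , y→x ← cyclicSubgroup-≡⇒power ms>0 x∈ (sym eq)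
    -- From x = y^j = x^(j * (k % n)) it follows that j inverts k % n modulo ord x, so k % n is
    -- coprime to it.
    = k % n , ∈-filter⁺ unit? (∈-upTo⁺ (m%n<n k n)) (coprime⇒gcd≡1 (invertible⇒unit {j} {k % n} n∣jk-1)) , sym kx≡y
    where
    kx≡y : pow ms (k % n) x ≡ y
    kx≡y = trans (∣⇒pow-≡ ms>0 x (k % n) k (n∣∣k%n-k∣ k n)) x→y
    n∣jk-1 : n ∣ ∣ j * (k % n) - 1 ∣
    n∣jk-1 = pow-≡⇒∣ ms>0 x (j * (k % n)) 1 (begin
      pow ms (j * (k % n)) x        ≡⟨ pow-pow ms j (k % n) x ⟨
      pow ms j (pow ms (k % n) x)   ≡⟨ cong (pow ms j) kx≡y ⟩
      pow ms j y                    ≡⟨ y→x ⟩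
      x                             ≡⟨ pow-1 x∈ ⟨
      pow ms 1 x                    ∎)

-- Counting subgroups by order vector

-- Chooses one generator for each entry of the deduplicated list of subgroups.
preimages : ∀ (f : A → B) xs ys → (∀ {y} → y ∈ ys → y ∈ map f xs) →
  ∃ λ zs → map f zs ≡ ys × (∀ {z} → z ∈ zs → z ∈ xs)
preimages f xs []       _  = [] , refl , λ ()
preimages f xs (y ∷ ys) h
  with x , x∈ , y≡ ← ∈-map⁻ f (h (here refl))
  with zs , eq , zs⊆ ← preimages f xs ys (h ∘ there)
  = x ∷ zs , cong₂ _∷_ (sym y≡) eq , λ { (here refl) → x∈ ; (there z∈) → zs⊆ z∈ }

-- Abstract, since `with` would otherwise normalise the list of representatives at every use.
abstract
  c-by-orders : ∀ {ms : Vec ℕ r} → Positive ms → ∃ λ (N : Vec ℕ r → ℕ) →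
    (∀ {ds} → ds ∈ divisorTuples ms → N ds * φ (lcmVec ds) ≡ prodVec (Vec.map φ ds))
    × c ms ≡ ∑ (divisorTuples ms) N
  c-by-orders {r} {ms} ms>0
    with reps , map≡ , reps⊆ ← preimages (cyclicSubgroup ms) (elems ms)
           (deduplicate _≟ᵇ_ (map (cyclicSubgroup ms) (elems ms))) (∈-deduplicate⁻ _≟ᵇ_ _)
    = N , N-φ , total
    where
    ⟨_⟩ : Vec ℕ r → List Bool
    ⟨_⟩ = cyclicSubgroup ms
    G : List (Vec ℕ r)
    G = elems ms
    subgroups : List (List Bool)
    subgroups = deduplicate _≟ᵇ_ (map ⟨_⟩ G)
    -- Each subgroup has one entry in `reps`, and its generators share an order vector, so this
    -- counts the subgroups of order vector `ds` whichever generators were chosen.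
    N : Vec ℕ r → ℕ
    N ds = ∑ reps (λ x → ⟦ orders ms x ≟ᵛ ds ⟧)

    total : c ms ≡ ∑ (divisorTuples ms) N
    total = begin
      length subgroups                            ≡⟨ cong length map≡ ⟨
      length (map ⟨_⟩ reps)                       ≡⟨ ListP.length-map ⟨_⟩ reps ⟩
      length reps                                 ≡⟨ ∑-one reps ⟨
      ∑ reps (λ _ → 1)                            ≡⟨ ∑-cong reps (λ x _ →
                                                     ∑-δ _≟ᵛ_ (divisorTuples-unique ms) (orders∈divisorTuples ms>0 x)) ⟨
      ∑ reps (λ x → ∑ (divisorTuples ms) (λ ds → ⟦ orders ms x ≟ᵛ ds ⟧))
                                                  ≡⟨ ∑-swap (λ x ds → ⟦ orders ms x ≟ᵛ ds ⟧) reps (divisorTuples ms) ⟩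
      ∑ (divisorTuples ms) N                      ∎

    one-rep : ∀ {y} → y ∈ G → ∑ reps (λ x → ⟦ ⟨ y ⟩ ≟ᵇ ⟨ x ⟩ ⟧) ≡ 1
    one-rep {y} y∈ = begin
      ∑ reps (λ x → ⟦ ⟨ y ⟩ ≟ᵇ ⟨ x ⟩ ⟧)           ≡⟨ ∑-map (λ S → ⟦ ⟨ y ⟩ ≟ᵇ S ⟧) ⟨_⟩ reps ⟨
      ∑ (map ⟨_⟩ reps) (λ S → ⟦ ⟨ y ⟩ ≟ᵇ S ⟧)     ≡⟨ cong (λ Ss → ∑ Ss (λ S → ⟦ ⟨ y ⟩ ≟ᵇ S ⟧)) map≡ ⟩
      ∑ subgroups (λ S → ⟦ ⟨ y ⟩ ≟ᵇ S ⟧)          ≡⟨ ∑-δ _≟ᵇ_ (DecUnique.deduplicate-! _≟ᵇ_ (map ⟨_⟩ G))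
                                                         (∈-deduplicate⁺ _≟ᵇ_ (∈-map⁺ ⟨_⟩ y∈)) ⟩
      1                                           ∎

    same-orders : ∀ {x y} → x ∈ G → y ∈ G → ⟨ x ⟩ ≡ ⟨ y ⟩ → orders ms x ≡ orders ms y
    same-orders x∈ y∈ eq
      with k , x→y ← cyclicSubgroup-≡⇒power ms>0 y∈ eq
      with j , y→x ← cyclicSubgroup-≡⇒power ms>0 x∈ (sym eq)
      = mutual-powers⇒orders≡ ms>0 k j x→y y→x

    -- Counts pairs (x, y) with x in `reps`, ⟨x⟩ = ⟨y⟩ and order vector `ds`. For fixed x there are
    -- φ(ord x) = φ(lcm ds) such y; for fixed y there is exactly one x, which leaves the number of
    -- elements with order vector `ds`.
    N-φ : ∀ {ds} → ds ∈ divisorTuples ms → N ds * φ (lcmVec ds) ≡ prodVec (Vec.map φ ds)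
    N-φ {ds} ds∈ = begin
      N ds * φ (lcmVec ds)
        ≡⟨ ∑-*ʳ (φ (lcmVec ds)) _ reps ⟨
      ∑ reps (λ x → ⟦ orders ms x ≟ᵛ ds ⟧ * φ (lcmVec ds))
        ≡⟨ ∑-cong reps (λ x x∈ → count-generators x (reps⊆ x∈)) ⟩
      ∑ reps (λ x → ∑ G (λ y → ⟦ ⟨ y ⟩ ≟ᵇ ⟨ x ⟩ ⟧ * ⟦ orders ms y ≟ᵛ ds ⟧))
        ≡⟨ ∑-swap _ reps G ⟩
      ∑ G (λ y → ∑ reps (λ x → ⟦ ⟨ y ⟩ ≟ᵇ ⟨ x ⟩ ⟧ * ⟦ orders ms y ≟ᵛ ds ⟧))
        ≡⟨ ∑-cong G (λ y y∈ → trans (∑-*ʳ ⟦ orders ms y ≟ᵛ ds ⟧ _ reps)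
             (trans (cong (_* ⟦ orders ms y ≟ᵛ ds ⟧) (one-rep y∈)) (*-identityˡ _))) ⟩
      ∑ G (λ y → ⟦ orders ms y ≟ᵛ ds ⟧)
        ≡⟨ orders-count ms>0 ds∈ ⟩
      prodVec (Vec.map φ ds) ∎
      where
      -- When the subgroups coincide the order vectors do too, so the condition can be moved from x
      -- to y.
      swap-indicators : ∀ {x y} → x ∈ G → y ∈ G →
        ⟦ orders ms x ≟ᵛ ds ⟧ * ⟦ ⟨ x ⟩ ≟ᵇ ⟨ y ⟩ ⟧ ≡ ⟦ ⟨ y ⟩ ≟ᵇ ⟨ x ⟩ ⟧ * ⟦ orders ms y ≟ᵛ ds ⟧
      swap-indicators {x} {y} x∈ y∈ = begin
        ⟦ orders ms x ≟ᵛ ds ⟧ * ⟦ ⟨ x ⟩ ≟ᵇ ⟨ y ⟩ ⟧         ≡⟨ ⟦⟧-× (orders ms x ≟ᵛ ds) (⟨ x ⟩ ≟ᵇ ⟨ y ⟩) ⟨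
        ⟦ orders ms x ≟ᵛ ds ×-dec ⟨ x ⟩ ≟ᵇ ⟨ y ⟩ ⟧         ≡⟨ ⟦⟧-cong
            (orders ms x ≟ᵛ ds ×-dec ⟨ x ⟩ ≟ᵇ ⟨ y ⟩) (⟨ y ⟩ ≟ᵇ ⟨ x ⟩ ×-dec orders ms y ≟ᵛ ds)
            (λ (o , eq) → sym eq , trans (sym (same-orders x∈ y∈ eq)) o)
            (λ (eq , o) → trans (sym (same-orders y∈ x∈ eq)) o , sym eq) ⟩
        ⟦ ⟨ y ⟩ ≟ᵇ ⟨ x ⟩ ×-dec orders ms y ≟ᵛ ds ⟧         ≡⟨ ⟦⟧-× (⟨ y ⟩ ≟ᵇ ⟨ x ⟩) (orders ms y ≟ᵛ ds) ⟩
        ⟦ ⟨ y ⟩ ≟ᵇ ⟨ x ⟩ ⟧ * ⟦ orders ms y ≟ᵛ ds ⟧         ∎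
      lcm-orders : ∀ x → ⟦ orders ms x ≟ᵛ ds ⟧ * φ (lcmVec ds) ≡ ⟦ orders ms x ≟ᵛ ds ⟧ * φ (lcmVec (orders ms x))
      lcm-orders x with orders ms x ≟ᵛ ds
      ... | yes o≡ds = cong (λ o → 1 * φ (lcmVec o)) (sym o≡ds)
      ... | no  _    = refl
      count-generators : ∀ x → x ∈ G → ⟦ orders ms x ≟ᵛ ds ⟧ * φ (lcmVec ds) ≡
        ∑ G (λ y → ⟦ ⟨ y ⟩ ≟ᵇ ⟨ x ⟩ ⟧ * ⟦ orders ms y ≟ᵛ ds ⟧)
      count-generators x x∈ = begin
        ⟦ orders ms x ≟ᵛ ds ⟧ * φ (lcmVec ds)                      ≡⟨ lcm-orders x ⟩
        ⟦ orders ms x ≟ᵛ ds ⟧ * φ (lcmVec (orders ms x))           ≡⟨ cong (⟦ orders ms x ≟ᵛ ds ⟧ *_) (generators-count ms>0 x∈) ⟨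
        ⟦ orders ms x ≟ᵛ ds ⟧ * ∑ G (λ y → ⟦ ⟨ x ⟩ ≟ᵇ ⟨ y ⟩ ⟧)     ≡⟨ ∑-*ˡ ⟦ orders ms x ≟ᵛ ds ⟧ _ G ⟨
        ∑ G (λ y → ⟦ orders ms x ≟ᵛ ds ⟧ * ⟦ ⟨ x ⟩ ≟ᵇ ⟨ y ⟩ ⟧)     ≡⟨ ∑-cong G (λ y y∈ → swap-indicators x∈ y∈) ⟩
        ∑ G (λ y → ⟦ ⟨ y ⟩ ≟ᵇ ⟨ x ⟩ ⟧ * ⟦ orders ms y ≟ᵛ ds ⟧)     ∎

-- Nonvanishing and multiplicativity

φ-lcmVec-nonZero : ∀ {ms ds : Vec ℕ r} → Positive ms → ds ∈ divisorTuples ms → NonZero (φ (lcmVec ds))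
φ-lcmVec-nonZero {ds = ds} ms>0 ds∈ = φ-nonZero (lcmVec ds) {{lcmVec-positive (divisorTuples-positive ms>0 ds∈)}}

c≢0 : ∀ {ms : Vec ℕ r} → Positive ms → c ms ≢ 0
-- The trivial subgroup is in the list: the identity `e ms` lies in the group as its own zeroth
-- power.
c≢0 {ms = ms} ms>0 = nonempty (∈-deduplicate⁺ _≟ᵇ_ (∈-map⁺ (cyclicSubgroup ms) (pow∈elems ms>0 0 (e ms))))
  where
  nonempty : ∀ {x : A} {xs} → x ∈ xs → length xs ≢ 0
  nonempty (here _)  ()
  nonempty (there _) ()

ones-positive : ∀ r → Positive (Vec.replicate r 1)
ones-positive zero    = []
ones-positive (suc r) = s≤s z≤n ∷ ones-positive r

*-positive : ∀ {ms ns : Vec ℕ r} → Positive ms → Positive ns → Positive (zipWith _*_ ms ns)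
*-positive []           []           = []
*-positive (m>0 ∷ ms>0) (n>0 ∷ ns>0) = *-mono-≤ m>0 n>0 ∷ *-positive ms>0 ns>0

divisorTuples-* : ∀ {ms ns ds es : Vec ℕ r} → Positive ms → Positive ns →
  ds ∈ divisorTuples ms → es ∈ divisorTuples ns → zipWith _*_ ds es ∈ divisorTuples (zipWith _*_ ms ns)
divisorTuples-* {ds = []} {[]} [] [] _ _ = here refl
divisorTuples-* {ms = m ∷ ms} {n ∷ ns} {d ∷ ds} {e ∷ es} (m>0 ∷ ms>0) (n>0 ∷ ns>0) ds∈ es∈
  with d∣m , ds∈ ← ∈-divisorTuples⁻ m ms ds∈
  with e∣n , es∈ ← ∈-divisorTuples⁻ n ns es∈
  = ∈-tuples⁺ {Ls = Vec.map divisors (zipWith _*_ ms ns)}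
      (∈-divisors⁺ {{>-nonZero (*-mono-≤ m>0 n>0)}} (*-pres-∣ d∣m e∣n)) (divisorTuples-* ms>0 ns>0 ds∈ es∈)

-- Both the product of totients and φ(lcm) factor over coprime tuples, so `M ds * N es` satisfies
-- the equation that determines `K (zipWith _*_ ds es)`. The divisor sum then splits into a product.
c-multiplicative : ∀ {ms ns : Vec ℕ r} → Positive ms → Positive ns → Coprime (prodVec ms) (prodVec ns) →
  c (zipWith _*_ ms ns) ≡ c ms * c ns
c-multiplicative {r} {ms} {ns} ms>0 ns>0 co
  with M , M-φ , c-ms ← c-by-orders ms>0
  with N , N-φ , c-ns ← c-by-orders ns>0
  with K , K-φ , c-msns ← c-by-orders (*-positive ms>0 ns>0)
  = begin
  c (zipWith _*_ ms ns)                                  ≡⟨ c-msns ⟩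
  ∑ (divisorTuples (zipWith _*_ ms ns)) K                ≡⟨ ∑-divisorTuples-* ms>0 ns>0 co K ⟩
  ∑ (divisorTuples ms) (λ ds → ∑ (divisorTuples ns) (λ es → K (zipWith _*_ ds es)))
    ≡⟨ ∑-cong (divisorTuples ms) (λ ds ds∈ → ∑-cong (divisorTuples ns) (λ es es∈ → split ds∈ es∈)) ⟩
  ∑ (divisorTuples ms) (λ ds → ∑ (divisorTuples ns) (λ es → M ds * N es))
    ≡⟨ ∑-× M N (divisorTuples ms) (divisorTuples ns) ⟩
  ∑ (divisorTuples ms) M * ∑ (divisorTuples ns) N        ≡⟨ cong₂ _*_ c-ms c-ns ⟨
  c ms * c ns                                            ∎
  where
  split : ∀ {ds es} → ds ∈ divisorTuples ms → es ∈ divisorTuples ns → K (zipWith _*_ ds es) ≡ M ds * N es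
  split {ds} {es} ds∈ es∈ = *-cancelʳ-≡ _ _ (φ (lcmVec dses)) {{φ-lcmVec-nonZero (*-positive ms>0 ns>0) dses∈}} (begin
    K dses * φ (lcmVec dses)                             ≡⟨ K-φ dses∈ ⟩
    prodVec (Vec.map φ dses)                             ≡⟨ prodVec-φ-* (divisorTuples-positive ms>0 ds∈) coprime ⟩
    prodVec (Vec.map φ ds) * prodVec (Vec.map φ es)      ≡⟨ cong₂ _*_ (M-φ ds∈) (N-φ es∈) ⟨
    M ds * φ (lcmVec ds) * (N es * φ (lcmVec es))        ≡⟨ interchange (M ds) (φ (lcmVec ds)) (N es) _ ⟩
    M ds * N es * (φ (lcmVec ds) * φ (lcmVec es))        ≡⟨ cong (M ds * N es *_)
                                                              (φ-*-coprime {{lcmVec-positive (divisorTuples-positive ms>0 ds∈)}}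
                                                                (coprime-∣ (lcmVec∣prodVec ds) (lcmVec∣prodVec es) coprime)) ⟨
    M ds * N es * φ (lcmVec ds * lcmVec es)              ≡⟨ cong (λ n → M ds * N es * φ n) (lcmVec-* ds es coprime) ⟨
    M ds * N es * φ (lcmVec dses)                        ∎)
    where
    dses : Vec ℕ r
    dses = zipWith _*_ ds es
    dses∈ : dses ∈ divisorTuples (zipWith _*_ ms ns)
    dses∈ = divisorTuples-* ms>0 ns>0 ds∈ es∈
    coprime : Coprime (prodVec ds) (prodVec es)
    coprime = coprime-∣ (divisorTuples-prodVec-∣ ms ds∈) (divisorTuples-prodVec-∣ ns es∈) co
    interchange : ∀ a x b y → a * x * (b * y) ≡ a * b * (x * y)
    interchange = solve-∀

-- Two cyclic factors

lcm-1 : ∀ n → lcm n 1 ≡ n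
lcm-1 n = ∣-antisym (lcm-least ∣-refl (1∣ n)) (m∣lcm[m,n] n 1)

φ-gcd-lcmVec : ∀ {d₁ d₂} → Positive (d₁ ∷ d₂ ∷ []) →
  prodVec (Vec.map φ (d₁ ∷ d₂ ∷ [])) ≡ φ (gcd d₁ d₂) * φ (lcmVec (d₁ ∷ d₂ ∷ []))
φ-gcd-lcmVec {d₁} {d₂} (d₁>0 ∷ _) = begin
  φ d₁ * (φ d₂ * 1)                    ≡⟨ cong (φ d₁ *_) (*-identityʳ (φ d₂)) ⟩
  φ d₁ * φ d₂                          ≡⟨ φ-gcd-lcm d₁ d₂ {{>-nonZero d₁>0}} ⟩
  φ (gcd d₁ d₂) * φ (lcm d₁ d₂)        ≡⟨ cong (λ n → φ (gcd d₁ d₂) * φ (lcm d₁ n)) (lcm-1 d₂) ⟨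
  φ (gcd d₁ d₂) * φ (lcm d₁ (lcm d₂ 1)) ∎

-- By φ(d₁)φ(d₂) = φ(gcd)φ(lcm), the number φ(gcd) satisfies the equation that determines the count
-- for (d₁, d₂).
c-rank2 : ∀ m₁ m₂ → 1 ≤ m₁ → 1 ≤ m₂ → c (m₁ ∷ m₂ ∷ []) ≡
  ∑ (divisorTuples (m₁ ∷ m₂ ∷ [])) (λ ds → φ (gcd (Vec.head ds) (Vec.head (Vec.tail ds))))
c-rank2 m₁ m₂ m₁>0 m₂>0 = trans (proj₂ (proj₂ count)) (∑-cong (divisorTuples ms) pointwise)
  where
  ms : Vec ℕ 2
  ms = m₁ ∷ m₂ ∷ []
  ms>0 : Positive ms
  ms>0 = m₁>0 ∷ m₂>0 ∷ []
  count = c-by-orders ms>0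
  pointwise : ∀ ds → ds ∈ divisorTuples ms → proj₁ count ds ≡ φ (gcd (Vec.head ds) (Vec.head (Vec.tail ds)))
  pointwise ds@(d₁ ∷ d₂ ∷ []) ds∈ = *-cancelʳ-≡ _ _ (φ (lcmVec ds)) {{φ-lcmVec-nonZero ms>0 ds∈}}
    (trans (proj₁ (proj₂ count) ds∈) (φ-gcd-lcmVec (divisorTuples-positive ms>0 ds∈)))

-- Two cyclic factors of prime-power order

module _ {p} (pp : Prime p) where
  private instance
    p≢0 : NonZero p
    p≢0 = prime⇒nonZero pp

  φ-^ : ∀ k → φ (p ^ suc k) ≡ (p ∸ 1) * p ^ k
  φ-^ zero    = φ-*-∤ pp (λ p∣1 → nonTrivial⇒≢1 {{prime⇒nonTrivial pp}} (∣1⇒≡1 p∣1))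
  φ-^ (suc k) = begin
    φ (p * p ^ suc k)         ≡⟨ φ-*-∣ {p} {p ^ suc k} (m∣m*n (p ^ k)) ⟩
    p * φ (p ^ suc k)         ≡⟨ cong (p *_) (φ-^ k) ⟩
    p * ((p ∸ 1) * p ^ k)     ≡⟨ left-commute p (p ∸ 1) (p ^ k) ⟩
    (p ∸ 1) * p ^ suc k       ∎
    where
    left-commute : ∀ a b x → a * (b * x) ≡ b * (a * x)
    left-commute = solve-∀

  -- Gauss's divisor sum of `φ` at p^k: each new term (p - 1) p^k raises the sum from p^k to
  -- p^(k+1).
  ∑-φ-^ : ∀ k → ∑< (suc k) (λ j → φ (p ^ j)) ≡ p ^ k
  ∑-φ-^ zero    = refl
  ∑-φ-^ (suc k) = begin
    ∑< (suc (suc k)) (λ j → φ (p ^ j))                ≡⟨ ∑<-last (suc k) (λ j → φ (p ^ j)) ⟩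
    ∑< (suc k) (λ j → φ (p ^ j)) + φ (p ^ suc k)      ≡⟨ cong₂ _+_ (∑-φ-^ k) (φ-^ k) ⟩
    (1 + (p ∸ 1)) * p ^ k                             ≡⟨ cong (_* p ^ k) (m+[n∸m]≡n (>-nonZero⁻¹ p)) ⟩
    p * p ^ k                                         ∎

  φgcd : ℕ → ℕ → ℕ
  φgcd i j = φ (gcd (p ^ i) (p ^ j))

  φgcd-≤ : ∀ {i j} → i ≤ j → φgcd i j ≡ φ (p ^ i)
  φgcd-≤ {i} {j} i≤j = cong φ
    (∣-antisym (gcd[m,n]∣m (p ^ i) (p ^ j)) (gcd-greatest ∣-refl (m≤n⇒p^m∣p^n p i≤j)))

  φgcd-≥ : ∀ {i j} → j ≤ i → φgcd i j ≡ φ (p ^ j)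
  φgcd-≥ {i} {j} j≤i = trans (cong φ (gcd-comm (p ^ i) (p ^ j))) (φgcd-≤ j≤i)

  gridSum : ℕ → ℕ → ℕ
  gridSum u v = ∑< (suc u) (λ i → ∑< (suc v) (φgcd i))

  -- For j ≤ v ≤ i the gcd is p^j, so the row is the divisor sum of `φ` at p^v.
  ∑-row : ∀ {i} v → v ≤ i → ∑< (suc v) (φgcd i) ≡ p ^ v
  ∑-row v v≤i = trans (∑<-cong (suc v) (λ j j≤v → φgcd-≥ (≤-trans (≤-pred j≤v) v≤i))) (∑-φ-^ v)

  -- Enlarging the square from v to v + 1 adds a column with entries φ(p^i), i ≤ v, of sum p^v, and
  -- a full row of sum p^(v+1).
  gridSum-diagonal : ∀ v → gridSum v v ≡ 2 * ∑< v (p ^_) + p ^ v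
  gridSum-diagonal zero    = refl
  gridSum-diagonal (suc v) = begin
    gridSum (suc v) (suc v)
      ≡⟨ ∑<-last (suc v) (λ i → ∑< (suc (suc v)) (φgcd i)) ⟩
    ∑< (suc v) (λ i → ∑< (suc (suc v)) (φgcd i)) + ∑< (suc (suc v)) (φgcd (suc v))
      ≡⟨ cong₂ _+_ (∑<-cong (suc v) (λ i i≤v → trans (∑<-last (suc v) (φgcd i))
           (cong (∑< (suc v) (φgcd i) +_) (φgcd-≤ (<⇒≤ i≤v))))) (∑-row (suc v) ≤-refl) ⟩
    ∑< (suc v) (λ i → ∑< (suc v) (φgcd i) + φ (p ^ i)) + p ^ suc v
      ≡⟨ cong (_+ p ^ suc v) (∑-+ (λ i → ∑< (suc v) (φgcd i)) (λ i → φ (p ^ i)) (upTo (suc v))) ⟩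
    gridSum v v + ∑< (suc v) (λ i → φ (p ^ i)) + p ^ suc v
      ≡⟨ cong₂ (λ a b → a + b + p ^ suc v) (gridSum-diagonal v) (∑-φ-^ v) ⟩
    2 * ∑< v (p ^_) + p ^ v + p ^ v + p ^ suc v
      ≡⟨ collect (∑< v (p ^_)) (p ^ v) (p ^ suc v) ⟩
    2 * (∑< v (p ^_) + p ^ v) + p ^ suc v
      ≡⟨ cong (λ s → 2 * s + p ^ suc v) (∑<-last v (p ^_)) ⟨
    2 * ∑< (suc v) (p ^_) + p ^ suc v ∎
    where
    collect : ∀ s a b → 2 * s + a + a + b ≡ 2 * (s + a) + b
    collect = solve-∀

  -- Writing u = k + v avoids truncated subtraction in the induction; each of the k rows beyond the
  -- square contributes p^v.
  gridSum-closed : ∀ k v → gridSum (k + v) v ≡ 2 * ∑< v (p ^_) + (k + 1) * p ^ v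
  gridSum-closed zero    v = trans (gridSum-diagonal v) (cong (λ a → 2 * ∑< v (p ^_) + a) (sym (*-identityˡ (p ^ v))))
  gridSum-closed (suc k) v = begin
    gridSum (suc k + v) v                                    ≡⟨ ∑<-last (suc (k + v)) (λ i → ∑< (suc v) (φgcd i)) ⟩
    gridSum (k + v) v + ∑< (suc v) (φgcd (suc (k + v)))         ≡⟨ cong₂ _+_ (gridSum-closed k v) (∑-row v (m≤n⇒m≤1+n (m≤n+m v k))) ⟩
    2 * ∑< v (p ^_) + (k + 1) * p ^ v + p ^ v          ≡⟨ collect (2 * ∑< v (p ^_)) k (p ^ v) ⟩
    2 * ∑< v (p ^_) + (suc k + 1) * p ^ v              ∎
    where
    collect : ∀ s k a → s + (k + 1) * a + a ≡ s + (suc k + 1) * a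
    collect = solve-∀

  c-prime-powers : ∀ {u v} → v ≤ u → c (p ^ u ∷ p ^ v ∷ []) ≡ 2 * ∑< v (p ^_) + (u ∸ v + 1) * p ^ v
  c-prime-powers {u} {v} v≤u = begin
    c (p ^ u ∷ p ^ v ∷ [])
      ≡⟨ c-rank2 (p ^ u) (p ^ v) (m^n>0 p u) (m^n>0 p v) ⟩
    ∑ (divisorTuples (p ^ u ∷ p ^ v ∷ [])) h
      ≡⟨ ∑-tuples h (divisors (p ^ u)) (divisors (p ^ v) ∷ []) ⟩
    ∑ (divisors (p ^ u)) (λ d₁ → ∑ (tuples (divisors (p ^ v) ∷ [])) (λ ds → h (d₁ ∷ ds)))
      ≡⟨ ∑-cong (divisors (p ^ u)) (λ d₁ _ → trans (∑-tuples (λ ds → h (d₁ ∷ ds)) (divisors (p ^ v)) [])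
           (∑-cong (divisors (p ^ v)) (λ d₂ _ → +-identityʳ _))) ⟩
    ∑ (divisors (p ^ u)) (λ d₁ → ∑ (divisors (p ^ v)) (λ d₂ → φ (gcd d₁ d₂)))
      ≡⟨ ∑-divisors-^ u pp _ ⟩
    ∑< (suc u) (λ i → ∑ (divisors (p ^ v)) (λ d₂ → φ (gcd (p ^ i) d₂)))
      ≡⟨ ∑<-cong (suc u) (λ i _ → ∑-divisors-^ v pp (λ d₂ → φ (gcd (p ^ i) d₂))) ⟩
    gridSum u v
      ≡⟨ cong (λ w → gridSum w v) (m∸n+n≡m v≤u) ⟨
    gridSum (u ∸ v + v) v
      ≡⟨ gridSum-closed (u ∸ v) v ⟩
    2 * ∑< v (p ^_) + (u ∸ v + 1) * p ^ v ∎
    where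
    h : Vec ℕ 2 → ℕ
    h ds = φ (gcd (Vec.head ds) (Vec.head (Vec.tail ds)))

-- Opened only here because +_ would clash with the sections (n +_) above.
open import Data.Integer using (+_)
import Data.Integer as ℤ
import Data.Integer.Properties as ℤP
open import Data.Rational using (ℚ; _/_; toℚᵘ)
import Data.Rational as ℚ
import Data.Rational.Properties as ℚP
open import Data.Rational.Unnormalised using (mkℚᵘ; *≡*)
import Data.Rational.Unnormalised as ℚᵘ
import Data.Rational.Unnormalised.Properties as ℚᵘP

-- From natural numbers to rational fractions

-- `_/_` is definitionally `fromℚᵘ` of an unreduced fraction, so cross-multiplication suffices and
-- gcd normalisation is never unfolded.
//-exact : ∀ {a b n} {{_ : NonZero b}} → n * b ≡ a → a // b ≡ (+ n) / 1
//-exact {a} {suc b} {n} nb≡a = ℚP.fromℚᵘ-cong {mkℚᵘ (+ a) b} {mkℚᵘ (+ n) 0} (*≡* (begin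
  + a ℤ.* + 1        ≡⟨ ℤP.*-identityʳ (+ a) ⟩
  + a                ≡⟨ cong +_ nb≡a ⟨
  + (n * suc b)      ≡⟨ ℤP.pos-* n (suc b) ⟩
  + n ℤ.* + suc b    ∎))

/1-+ : ∀ m n → (+ (m + n)) / 1 ≡ (+ m) / 1 ℚ.+ (+ n) / 1
/1-+ m n = ℚP.toℚᵘ-injective (begin′
  toℚᵘ ((+ (m + n)) / 1)                    ≈⟨ ℚP.toℚᵘ-fromℚᵘ (mkℚᵘ (+ (m + n)) 0) ⟩
  mkℚᵘ (+ (m + n)) 0                        ≈⟨ *≡* numerators ⟩
  mkℚᵘ (+ m) 0 ℚᵘ.+ mkℚᵘ (+ n) 0            ≈⟨ ℚᵘP.+-cong (ℚP.toℚᵘ-fromℚᵘ (mkℚᵘ (+ m) 0)) (ℚP.toℚᵘ-fromℚᵘ (mkℚᵘ (+ n) 0)) ⟨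
  toℚᵘ ((+ m) / 1) ℚᵘ.+ toℚᵘ ((+ n) / 1)    ≈⟨ ℚP.toℚᵘ-homo-+ ((+ m) / 1) ((+ n) / 1) ⟨
  toℚᵘ ((+ m) / 1 ℚ.+ (+ n) / 1)            ∎′)
  where
  open ℚᵘP.≃-Reasoning renaming (begin_ to begin′_; _∎ to _∎′)
  numerators : + (m + n) ℤ.* + 1 ≡ (+ m ℤ.* + 1 ℤ.+ + n ℤ.* + 1) ℤ.* + 1
  numerators = cong (ℤ._* + 1) (cong₂ ℤ._+_ (sym (ℤP.*-identityʳ (+ m))) (sym (ℤP.*-identityʳ (+ n))))

∑/1 : ∀ (f : A → ℕ) (g : A → ℚ) xs → (∀ {x} → x ∈ xs → g x ≡ (+ f x) / 1) → (+ ∑ xs f) / 1 ≡ sumℚ (map g xs)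
∑/1 f g []       _ = refl
∑/1 f g (x ∷ xs) h = trans (/1-+ (f x) (∑ xs f)) (cong₂ ℚ._+_ (sym (h (here refl))) (∑/1 f g xs (h ∘ there)))

-- Every summand is the natural number `N ds`, so the rational sum is the image of the natural one.
c-formula : ∀ {ms : Vec ℕ r} → Positive ms →
  (+ c ms) / 1 ≡ sumℚ (map (λ ds → prodVec (Vec.map φ ds) // φ (lcmVec ds)) (divisorTuples ms))
c-formula {ms = ms} ms>0 with N , N-φ , c≡ ← c-by-orders ms>0 =
  trans (cong (λ n → (+ n) / 1) c≡)
        (∑/1 N _ (divisorTuples ms) (λ {ds} ds∈ → //-exact {n = N ds} {{φ-lcmVec-nonZero ms>0 ds∈}} (N-φ ds∈)))

theorem3 : ((r : ℕ) → 1 ≤ r → (ms : Vec ℕ r) → Positive ms →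
    (+ c ms) / 1 ≡
    sumℚ (map (λ ds → prodVec (Data.Vec.map φ ds) // φ (lcmVec ds)) (divisorTuples ms)))
    × ((r : ℕ) → 1 ≤ r →
    (∃ λ (ms : Vec ℕ r) → Positive ms × c ms ≢ 0)
    × ((ms ns : Vec ℕ r) → Positive ms → Positive ns →
    Coprime (prodVec ms) (prodVec ns) →
    c (zipWith _*_ ms ns) ≡ c ms * c ns))
    × ((m₁ m₂ : ℕ) → 1 ≤ m₁ → 1 ≤ m₂ →
    c (m₁ ∷ m₂ ∷ []) ≡
    sumℕ (map (λ ds → φ (gcd (Data.Vec.head ds) (Data.Vec.head (Data.Vec.tail ds))))
    (divisorTuples (m₁ ∷ m₂ ∷ []))))
    × ((p u v : ℕ) → Prime p → 1 ≤ v → v ≤ u →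
    c (p ^ u ∷ p ^ v ∷ []) ≡
    2 * sumℕ (map (p ^_) (upTo v)) + (u ∸ v + 1) * p ^ v)
theorem3 =
    (λ r _ ms ms>0 → c-formula ms>0)
  , (λ r _ → (Vec.replicate r 1 , ones-positive r , c≢0 (ones-positive r))
           , (λ ms ns ms>0 ns>0 co → c-multiplicative ms>0 ns>0 co))
  , c-rank2
  , (λ p u v pp _ v≤u → c-prime-powers pp v≤u)
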